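{- Let $\Sigma$ be a finite alphabet and let $L\subseteq \Sigma^{\circledast}$ be a regular language of countable words. The following are equivalent. (1) $L$ is recognized by some finite shuffle-trivial $\circledast$-algebra. (2) $L$ is a boolean combination of languages of the form $B^{\circledast}$ where $B\subseteq\Sigma$. (3) $L$ is definable in $\mathrm{FO}^1$. (4) $L$ is recognized by a (finite) direct product of copies of $\mathrm{U}_1$. (5) The syntactic $\circledast$-algebra of $L$ is shuffle-trivial.
   Context: Words. A (countable) word over a set $A$ is a map $w$ from a countable, possibly empty, linear ordering $\mathrm{dom}(w)$ to $A$, taken up to isomorphism; $A^{\circledast}$ is the set of all such words (including the empty word $\varepsilon$). For words $(w_i)_{i\in\alpha}$ indexed by a countable linear ordering $\alpha$, $\prod_{i\in\alpha}w_i$ is their generalized concatenation. $w^{\omega}$ and $w^{\omega^*}$ are the concatenations of copies of $w$ indexed by $(\mathbb N,<)$ and $(-\mathbb N,<)$. For a finite nonempty set $E$, the perfect shuffle $E^{\eta}$ is the (unique up to isomorphism) word of domain $(\mathbb Q,<)$ using only letters of $E$ in which every nonempty non-singleton interval contains every letter of $E$. Algebra. A $\circledast$-monoid $(M,\mathrm{id},\pi)$ is a set $M$ with a map $\pi:M^{\circledast}\to M$ such that $\pi(a)=a$ for $a\in M$, $\pi(\prod_{i\in\alpha}u_i)=\pi(\prod_{i\in\alpha}\pi(u_i))$ for all countable linear orderings $\alpha$ and words $u_i$ over $M$ (generalized associativity), and $\mathrm{id}=\pi(\varepsilon)$. It induces the $\circledast$-algebra $(M,\mathrm{id},\cdot,\tau,\tau^*,\kappa)$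 with derived operations $a\cdot b=\pi(ab)$, $a^{\tau}=\pi(a^{\omega})$, $a^{\tau^*}=\pi(a^{\omega^*})$, $E^{\kappa}=\pi(E^{\eta})$ for nonempty finite $E\subseteq M$. A finite $\circledast$-monoid is determined by its $\circledast$-algebra, and the two are identified. A morphism $h:M\to M'$ of $\circledast$-monoids satisfies $h(\pi(w))=\pi'(\bar h(w))$, where $\bar h$ is the letterwise extension of $h$. $\Sigma^{\circledast}$ with generalized concatenation is the free $\circledast$-monoid over $\Sigma$. $L\subseteq\Sigma^{\circledast}$ is recognized by $M$ if there is a morphism $h:\Sigma^{\circledast}\to M$ with $L=h^{ -1}(h(L))$. $L$ is regular if it is recognized by some finite $\circledast$-monoid (equivalently, MSO-definable). $M$ divides $M'$ if $M$ is the image under a surjective morphism of a sub-$\circledast$-monoid of $M'$. The syntactic $\circledast$-algebra of a regular $L$ is its canonical (minimal) finite recognizing $\circledast$-algebra; it recognizes $L$ and divides every $\circledast$-algebra recognizing $L$. A $\circledast$-algebra is shuffle-trivial if $\{x_1,\dots,x_p\}^{\kappa}=x_1\cdot x_2\cdots x_p$ for all $p\ge 1$ and all $x_1,\dots,x_p\in M$. $\mathrm{U}_1$ is the $\circledast$-monoid $(\{\mathrm{id},0\},\mathrm{id},\pi)$ with $\pi(u)=\mathrm{id}$ if $u\in\{\mathrm{id}\}^{\circledast}$ and $\pi(u)=0$ otherwise. Logic. First-order logic FO over words: formulas are built from $x<y$, $a(x)$ ($a\in\Sigma$; "position $x$ carries letter $a$"), boolean connectives, and $\exists x$, with variables ranging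 over positions of the word. $\mathrm{FO}^1$ is the fragment using only one variable. A language is definable in a logic if it is the set of words satisfying some sentence of the logic. -}

module Defs where

open import Axiom.ExcludedMiddle using (ExcludedMiddle)
open import Data.Bool using (if_then_else_)
open import Data.Empty using (⊥-elim)
open import Data.Fin using (Fin; zero; suc; toℕ)
import Data.Fin.Properties as Fin
open import Data.Integer as ℤ using (ℤ; +_; -[1+_])
import Data.Integer.Divisibility.Signed as ℤₛ
import Data.Integer.Properties as ℤ
import Data.Integer.Tactic.RingSolver as ℤ-Solver
open import Data.Maybe using (Maybe; just; nothing)
open import Data.Nat as ℕ using (ℕ; zero; suc)
import Data.Nat.Coprimality as ℕ
import Data.Nat.Divisibility as ℕ
open import Data.Nat.DivMod using (_mod_; _%_; [m+kn]%n≡m%n; m<n⇒m%n≡m)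
open import Data.Nat.Logarithm using (⌊log₂_⌋; ⌊log₂[2*b]⌋≡1+⌊log₂b⌋)
import Data.Nat.Properties as ℕ
import Data.Nat.Tactic.RingSolver as ℕ-Solver
open import Data.Product using (Σ; ∃-syntax; _×_; _,_; proj₁; proj₂)
open import Data.Rational as ℚ using (ℚ; mkℚ; *<*; ↧ₙ_)
import Data.Rational.Properties as ℚ
open import Data.Sum using (_⊎_)
open import Data.Vec using (Vec; []; _∷_; lookup; foldr₁)
open import Function using (_∘_; Inverse; Injection; _↔_; _↣_; mk↣; mk↔ₛ′; mk⇔)
open import Level using (Level; 0ℓ; _⊔_) renaming (suc to lsuc)
open import Relation.Binary using (Rel; Setoid; IsStrictTotalOrder; Tri; tri<; tri≈; tri>)
open import Relation.Binary.PropositionalEquality as ≡ using (_≡_; refl; cong; cong₂; subst)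
open import Relation.Nullary using (¬_; yes; no; does)
open import Relation.Nullary.Decidable using (does-⇔)
open import Relation.Unary using (Pred; _≐_; ∁; _∩_; _∪_; _∈_)

private
  variable
    a b c ℓ c′ ℓ′ p : Level
    A B : Set a
    n k : ℕ

FiniteSetoid : Setoid c ℓ → Set (c ⊔ ℓ)
FiniteSetoid S = ∃[ n ] Inverse S (≡.setoid (Fin n))

Finite : Set a → Set a
Finite A = FiniteSetoid (≡.setoid A)

private
  double : ℕ → ℕ
  double zero    = zero
  double (suc n) = suc (suc (double n))

  double-injective : ∀ m n → double m ≡ double n → m ≡ n
  double-injective zero    zero    _  = refl
  double-injective (suc m) (suc n) eq =
    cong suc (double-injective m n (ℕ.suc-injective (ℕ.suc-injective eq)))

  even≢odd : ∀ m n → ¬ double m ≡ suc (double n)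
  even≢odd (suc m) (suc n) eq = even≢odd m n (ℕ.suc-injective (ℕ.suc-injective eq))

-- (m , n) ↦ 2ᵐ (2n + 1)
pair : ℕ → ℕ → ℕ
pair zero    n = suc (double n)
pair (suc m) n = double (pair m n)

pair-injective : ∀ m n m′ n′ → pair m n ≡ pair m′ n′ → m ≡ m′ × n ≡ n′
pair-injective zero n zero n′ eq = refl , double-injective n n′ (ℕ.suc-injective eq)
pair-injective zero n (suc m′) n′ eq = ⊥-elim (even≢odd (pair m′ n′) n (≡.sym eq))
pair-injective (suc m) n zero n′ eq = ⊥-elim (even≢odd (pair m n) n′ eq)
pair-injective (suc m) n (suc m′) n′ eq
  with pair-injective m n m′ n′ (double-injective (pair m n) (pair m′ n′) eq)
... | refl , refl = refl , refl

ℤ↣ℕ : ℤ ↣ ℕ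
ℤ↣ℕ = mk↣ {to = code} (λ {x} {y} → injective x y)
  where
  code : ℤ → ℕ
  code (+ n)    = double n
  code -[1+ n ] = suc (double n)

  injective : ∀ x y → code x ≡ code y → x ≡ y
  injective (+ m)    (+ n)    eq = cong +_ (double-injective m n eq)
  injective (+ m)    -[1+ n ] eq = ⊥-elim (even≢odd m n eq)
  injective -[1+ m ] (+ n)    eq = ⊥-elim (even≢odd n m (≡.sym eq))
  injective -[1+ m ] -[1+ n ] eq = cong -[1+_] (double-injective m n (ℕ.suc-injective eq))

ℚ↣ℕ : ℚ ↣ ℕ
ℚ↣ℕ = mk↣ {to = code} (λ {x} {y} → injective x y)
  where
  open Injection ℤ↣ℕ using () renaming (to to codeℤ; injective to codeℤ-injective)

  code : ℚ → ℕ
  code (mkℚ n d _) = pair (codeℤ n) d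

  injective : ∀ x y → code x ≡ code y → x ≡ y
  injective (mkℚ n d _) (mkℚ n′ d′ _) eq with pair-injective (codeℤ n) d (codeℤ n′) d′ eq
  ... | eqₙ , refl with codeℤ-injective {n} {n′} eqₙ
  ...   | refl = refl

record CountableOrder : Set₁ where
  infix 4 _<_
  field
    Pos                : Set
    _<_                : Rel Pos 0ℓ
    isStrictTotalOrder : IsStrictTotalOrder _≡_ _<_
    countable          : Pos ↣ ℕ

  open IsStrictTotalOrder isStrictTotalOrder public using (compare; irrefl; asym)
    renaming (trans to <-trans)

Finₒ : ℕ → CountableOrder
Finₒ n = record
  { isStrictTotalOrder = Fin.<-isStrictTotalOrder {n}
  ; countable          = mk↣ Fin.toℕ-injective
  }

ℚₒ : CountableOrder
ℚₒ = record { isStrictTotalOrder = ℚ.<-isStrictTotalOrder ; countable = ℚ↣ℕ }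

module _ (I : CountableOrder) (J : CountableOrder.Pos I → CountableOrder) where
  private
    module I = CountableOrder I
    module J i = CountableOrder (J i)

  data Lex : Rel (Σ I.Pos J.Pos) 0ℓ where
    outer : ∀ {i j x y} → i I.< j → Lex (i , x) (j , y)
    inner : ∀ {i x y} → J._<_ i x y → Lex (i , x) (i , y)

  private
    Lex-irrefl : ∀ {p} → ¬ Lex p p
    Lex-irrefl (outer lt)     = I.irrefl refl lt
    Lex-irrefl (inner {i} lt) = J.irrefl i refl lt

    Lex-trans : ∀ {p q r} → Lex p q → Lex q r → Lex p r
    Lex-trans (outer lt)     (outer lt′) = outer (I.<-trans lt lt′)
    Lex-trans (outer lt)     (inner _)   = outer lt
    Lex-trans (inner _)      (outer lt)  = outer lt
    Lex-trans (inner {i} lt) (inner lt′) = inner (J.<-trans i lt lt′)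

    triLt : ∀ {p q} → Lex p q → Tri (Lex p q) (p ≡ q) (Lex q p)
    triLt lt = tri< lt (λ { refl → Lex-irrefl lt }) (λ gt → Lex-irrefl (Lex-trans lt gt))

    triGt : ∀ {p q} → Lex q p → Tri (Lex p q) (p ≡ q) (Lex q p)
    triGt gt = tri> (λ lt → Lex-irrefl (Lex-trans lt gt)) (λ { refl → Lex-irrefl gt }) gt

    Lex-compare : ∀ p q → Tri (Lex p q) (p ≡ q) (Lex q p)
    Lex-compare (i , x) (j , y) with I.compare i j
    ... | tri< lt _ _ = triLt (outer lt)
    ... | tri> _ _ gt = triGt (outer gt)
    ... | tri≈ _ refl _ with J.compare i x y
    ...   | tri< lt _ _   = triLt (inner lt)
    ...   | tri> _ _ gt   = triGt (inner gt)
    ...   | tri≈ _ refl _ = tri≈ Lex-irrefl refl Lex-irrefl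

    code : Σ I.Pos J.Pos → ℕ
    code (i , x) = pair (Injection.to I.countable i) (Injection.to (J.countable i) x)

    code-injective : ∀ p q → code p ≡ code q → p ≡ q
    code-injective (i , x) (j , y) eq with pair-injective (Injection.to I.countable i) _ _ _ eq
    ... | eqᵢ , eqₓ with Injection.injective I.countable {i} {j} eqᵢ
    ...   | refl with Injection.injective (J.countable i) {x} {y} eqₓ
    ...     | refl = refl

  Σₒ : CountableOrder
  Σₒ = record
    { _<_                = Lex
    ; isStrictTotalOrder = record
      { isStrictPartialOrder = record
        { isEquivalence = ≡.isEquivalence
        ; irrefl        = λ { refl → Lex-irrefl }
        ; trans         = Lex-trans
        ; <-resp-≈      = (λ { refl lt → lt }) , (λ { refl lt → lt })
        }
      ; compare = Lex-compare
      }
    ; countable = mk↣ (λ {p} {q} → code-injective p q)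
    }

-- Words are not quotiented by isomorphism; see `_≅_` in `WordEquality`.
record Word (A : Set a) : Set (a ⊔ lsuc 0ℓ) where
  field
    dom    : CountableOrder
    letter : CountableOrder.Pos dom → A

  open CountableOrder dom public

map : (A → B) → Word A → Word B
map f w = record { dom = Word.dom w ; letter = f ∘ Word.letter w }

finite : Vec A n → Word A
finite {n = n} xs = record { dom = Finₒ n ; letter = lookup xs }

-- A family of words indexed by a countable order is a word of words.
concat : Word (Word A) → Word A
concat u = record
  { dom    = Σₒ (Word.dom u) (λ i → Word.dom (Word.letter u i))
  ; letter = λ (i , x) → Word.letter (Word.letter u i) x
  }

module WordEquality (S : Setoid c ℓ) where
  private module S = Setoid S
  open S using (Carrier; _≈_)

  infix 4 _≅_

  -- Monotonicity of the inverse follows from totality.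
  record _≅_ (v w : Word Carrier) : Set ℓ where
    private
      module v = Word v
      module w = Word w
    field
      bijection : v.Pos ↔ w.Pos

    open Inverse bijection public using (to; from; strictlyInverseˡ; strictlyInverseʳ)

    field
      monotone : ∀ {x y} → x v.< y → to x w.< to y
      letters  : ∀ x → v.letter x ≈ w.letter (to x)

  monotone-surjection : ∀ {v w} (f : Word.Pos v → Word.Pos w) →
                        (∀ {x y} → Word._<_ v x y → Word._<_ w (f x) (f y)) →
                        (∀ y → ∃[ x ] f x ≡ y) →
                        (∀ x → Word.letter v x ≈ Word.letter w (f x)) → v ≅ w
  monotone-surjection {v} {w} f mono surj letters = record
    { bijection = mk↔ₛ′ f (proj₁ ∘ surj) (proj₂ ∘ surj)
                        (λ x → injective (proj₂ (surj (f x))))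
    ; monotone  = mono
    ; letters   = letters
    }
    where
    injective : ∀ {x y} → f x ≡ f y → x ≡ y
    injective {x} {y} eq with Word.compare v x y
    ... | tri< lt _ _  = ⊥-elim (Word.irrefl w eq (mono lt))
    ... | tri≈ _ x≡y _ = x≡y
    ... | tri> _ _ gt  = ⊥-elim (Word.irrefl w (≡.sym eq) (mono gt))

  ≅-refl : ∀ {w} → w ≅ w
  ≅-refl = monotone-surjection (λ x → x) (λ lt → lt) (λ y → y , refl) (λ _ → S.refl)

  ≅-sym : ∀ {v w} → v ≅ w → w ≅ v
  ≅-sym {v} {w} v≅w = monotone-surjection from mono (λ x → to x , strictlyInverseʳ x)
    (λ y → S.sym (S.trans (letters (from y)) (S.reflexive (cong (Word.letter w) (strictlyInverseˡ y)))))
    where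
    open _≅_ v≅w
    mono : ∀ {x y} → Word._<_ w x y → Word._<_ v (from x) (from y)
    mono {x} {y} x<y with Word.compare v (from x) (from y)
    ... | tri< lt _ _ = lt
    ... | tri≈ _ eq _ = ⊥-elim (Word.irrefl w
          (≡.trans (≡.sym (strictlyInverseˡ x)) (≡.trans (cong to eq) (strictlyInverseˡ y))) x<y)
    ... | tri> _ _ gt = ⊥-elim (Word.asym w x<y
          (≡.subst₂ (Word._<_ w) (strictlyInverseˡ y) (strictlyInverseˡ x) (monotone gt)))

  ≅-trans : ∀ {u v w} → u ≅ v → v ≅ w → u ≅ w
  ≅-trans f g = monotone-surjection (G.to ∘ F.to) (G.monotone ∘ F.monotone)
    (λ z → F.from (G.from z)
         , ≡.trans (cong G.to (F.strictlyInverseˡ (G.from z))) (G.strictlyInverseˡ z))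
    (λ x → S.trans (F.letters x) (G.letters (F.to x)))
    where
    module F = _≅_ f
    module G = _≅_ g

  wordSetoid : Setoid (c ⊔ lsuc 0ℓ) ℓ
  wordSetoid = record
    { Carrier       = Word Carrier
    ; _≈_           = _≅_
    ; isEquivalence = record { refl = ≅-refl ; sym = ≅-sym ; trans = ≅-trans }
    }

record ⊛Monoid c ℓ : Set (lsuc (c ⊔ ℓ ⊔ lsuc 0ℓ)) where
  field
    setoid : Setoid c ℓ

  open Setoid setoid public
  open WordEquality setoid public using (_≅_)

  field
    π           : Word Carrier → Carrier
    π-cong      : ∀ {v w} → v ≅ w → π v ≈ π w
    π-singleton : ∀ x → π (finite (x ∷ [])) ≈ x
    π-concat    : ∀ u → π (concat u) ≈ π (map π u)

  id : Carrier
  id = π (finite [])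

  infixr 7 _∙_
  _∙_ : Carrier → Carrier → Carrier
  x ∙ y = π (finite (x ∷ y ∷ []))

free : Set a → ⊛Monoid (a ⊔ lsuc 0ℓ) a
free A = record
  { setoid      = Letters.wordSetoid
  ; π           = concat
  ; π-cong      = concat-cong
  ; π-singleton = λ w → Letters.monotone-surjection
      (λ { (zero , x) → x })
      (λ { {zero , _} {zero , _} (inner lt) → lt ; {zero , _} {zero , _} (outer ()) })
      (λ y → (zero , y) , refl)
      (λ { (zero , _) → refl })
  ; π-concat    = λ u → Letters.monotone-surjection
      (λ ((i , j) , x) → i , (j , x))
      (λ { (outer (outer lt)) → outer lt
         ; (outer (inner lt)) → inner (outer lt)
         ; (inner lt)         → inner (inner lt) })
      (λ (i , (j , x)) → ((i , j) , x) , refl)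
      (λ _ → refl)
  }
  where
  module Letters = WordEquality (≡.setoid A)
  module Words   = WordEquality Letters.wordSetoid

  concat-cong : ∀ {u v} → u Words.≅ v → concat u Letters.≅ concat v
  concat-cong {u} {v} u≅v = Letters.monotone-surjection f
    (λ { (outer lt) → outer (O.monotone lt) ; (inner {i} lt) → inner (N.monotone i lt) })
    (λ (j , y) → surjective j y (O.from j) (O.strictlyInverseˡ j))
    (λ (i , x) → N.letters i x)
    where
    module O = Words._≅_ u≅v
    module N i = Letters._≅_ (O.letters i)

    f : Word.Pos (concat u) → Word.Pos (concat v)
    f (i , x) = O.to i , N.to i x

    surjective : ∀ j y i → O.to i ≡ j → ∃[ q ] f q ≡ (j , y)
    surjective .(O.to i) y i refl = (i , N.from i y) , cong (O.to i ,_) (N.strictlyInverseˡ i y)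

record Morphism (M : ⊛Monoid c ℓ) (N : ⊛Monoid c′ ℓ′) : Set (c ⊔ ℓ ⊔ c′ ⊔ ℓ′ ⊔ lsuc 0ℓ) where
  private
    module M = ⊛Monoid M
    module N = ⊛Monoid N
  field
    ⟦_⟧    : M.Carrier → N.Carrier
    ⟦⟧-cong : ∀ {x y} → x M.≈ y → ⟦ x ⟧ N.≈ ⟦ y ⟧
    homo   : ∀ w → ⟦ M.π w ⟧ N.≈ N.π (map ⟦_⟧ w)

record Sub⊛Monoid (M : ⊛Monoid c ℓ) p : Set (c ⊔ ℓ ⊔ lsuc (p ⊔ lsuc 0ℓ)) where
  open ⊛Monoid M
  field
    member   : Pred Carrier p
    respects : ∀ {x y} → x ≈ y → x ∈ member → y ∈ member
    closed   : ∀ w → (∀ i → Word.letter w i ∈ member) → π w ∈ member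

  ⊛monoid : ⊛Monoid (c ⊔ p) ℓ
  ⊛monoid = record
    { setoid      = record
      { Carrier       = Σ Carrier member
      ; _≈_           = λ x y → proj₁ x ≈ proj₁ y
      ; isEquivalence = record { refl = ⊛Monoid.refl M ; sym = ⊛Monoid.sym M ; trans = ⊛Monoid.trans M }
      }
    ; π           = λ w → π (map proj₁ w) , closed (map proj₁ w) (proj₂ ∘ Word.letter w)
    ; π-cong      = λ v≅w → π-cong (record { WordEquality._≅_ v≅w })
    ; π-singleton = λ (x , _) → trans (π-cong (singleton x)) (π-singleton x)
    ; π-concat    = λ u → π-concat (map (map proj₁) u)
    }
    where
    singleton : ∀ x {x∈} → map {B = Carrier} proj₁ (finite ((x , x∈) ∷ [])) ≅ finite (x ∷ [])
    singleton x = WordEquality.monotone-surjection setoid (λ i → i) (λ lt → lt) (λ i → i , ≡.refl)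
      (λ { zero → ⊛Monoid.refl M })

∏ : {I : Set} → (I → ⊛Monoid c ℓ) → ⊛Monoid c ℓ
∏ {I = I} M = record
  { setoid      = record
    { Carrier       = ∀ i → M.Carrier i
    ; _≈_           = λ x y → ∀ i → M._≈_ i (x i) (y i)
    ; isEquivalence = record
      { refl  = λ i → M.refl i
      ; sym   = λ x≈y i → M.sym i (x≈y i)
      ; trans = λ x≈y y≈z i → M.trans i (x≈y i) (y≈z i)
      }
    }
  ; π           = λ w i → M.π i (map (λ x → x i) w)
  ; π-cong      = λ v≅w i → M.π-cong i (record
      { bijection = WordEquality._≅_.bijection v≅w
      ; monotone  = WordEquality._≅_.monotone v≅w
      ; letters   = λ x → WordEquality._≅_.letters v≅w x i
      })
  ; π-singleton = λ x i → M.trans i (M.π-cong i (singleton x i)) (M.π-singleton i (x i))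
  ; π-concat    = λ u i → M.π-concat i (map (map (λ x → x i)) u)
  }
  where
  module M i = ⊛Monoid (M i)

  singleton : ∀ (x : ∀ i → M.Carrier i) i →
              WordEquality._≅_ (M.setoid i) (map (λ y → y i) (finite (x ∷ []))) (finite (x i ∷ []))
  singleton x i = WordEquality.monotone-surjection (M.setoid i) (λ j → j) (λ lt → lt)
    (λ j → j , refl) (λ { zero → M.refl i })

infixl 8 _^_
_^_ : ⊛Monoid c ℓ → ℕ → ⊛Monoid c ℓ
M ^ n = ∏ {I = Fin n} (λ _ → M)

Surjective : {M : ⊛Monoid c ℓ} {N : ⊛Monoid c′ ℓ′} → Morphism M N → Set _
Surjective {M = M} {N = N} h = ∀ y → ∃[ x ] ⟦ x ⟧ ≈ y
  where
  open Morphism h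
  open ⊛Monoid N

_Divides_ : ⊛Monoid c ℓ → ⊛Monoid c′ ℓ′ → Set _
_Divides_ {ℓ′ = ℓ′} M N =
  Σ (Sub⊛Monoid N ℓ′) λ S → Σ (Morphism (Sub⊛Monoid.⊛monoid S) M) Surjective

Language : Set a → ∀ ℓ → Set _
Language A ℓ = Pred (Word A) ℓ

-- A recognized language is invariant under isomorphism of words, since `h` is.
_Recognizes_ : {A : Set a} → ⊛Monoid c ℓ → Language A p → Set _
_Recognizes_ {A = A} M L =
  Σ (Morphism (free A) M) λ h → let open Morphism h; open ⊛Monoid M in
    L ≐ λ w → ∃[ v ] v ∈ L × ⟦ w ⟧ ≈ ⟦ v ⟧

IsFinite : ⊛Monoid c ℓ → Set _
IsFinite M = FiniteSetoid (⊛Monoid.setoid M)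

Regular : {A : Set a} → Language A p → Set _
Regular L = Σ (⊛Monoid 0ℓ 0ℓ) λ M → IsFinite M × M Recognizes L

-- Finite ⊛-monoids dividing each other are isomorphic, so this determines `S`
-- up to isomorphism.
record IsSyntactic {A : Set a} (S : ⊛Monoid 0ℓ 0ℓ) (L : Language A p) : Set (a ⊔ p ⊔ lsuc (lsuc 0ℓ)) where
  field
    isFinite   : IsFinite S
    recognizes : S Recognizes L
    minimal    : (M : ⊛Monoid 0ℓ 0ℓ) → M Recognizes L → S Divides M

-- The letter at a rational is the residue of ⌊log₂ d⌋, where d is its reduced
-- denominator; `shuffle-dense` below shows that every letter is then dense.
shuffle : Vec A (suc n) → Word A
shuffle {n = n} xs = record { dom = ℚₒ ; letter = λ q → lookup xs (⌊log₂ ↧ₙ q ⌋ mod suc n) }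

shuffle-dense : (xs : Vec A (suc n)) → ∀ {p q} → p ℚ.< q → ∀ i →
                ∃[ r ] p ℚ.< r × r ℚ.< q × Word.letter (shuffle xs) r ≡ lookup xs i
shuffle-dense {n = n} xs {p@(mkℚ u d-1 _)} {q@(mkℚ v e-1 _)} (*<* p<q) i =
  r , *<* p<r , *<* r<q , cong (lookup xs) colour
  where
  -- With t a large power of two, r = (u d t + 1) / (d² t) is in lowest terms and
  -- slightly larger than p = u / d.
  d e e′ s t D : ℕ
  d  = suc d-1
  e  = suc e-1
  e′ = ⌊log₂ d ℕ.* d ⌋
  s  = toℕ i ℕ.+ (n ℕ.* e′ ℕ.+ e ℕ.* suc n)
  t  = 2 ℕ.^ s
  D  = d ℕ.* (d ℕ.* t)

  instance
    t≢0 : ℕ.NonZero t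
    t≢0 = ℕ.m^n≢0 2 s
    dt≢0 : ℕ.NonZero (d ℕ.* t)
    dt≢0 = ℕ.m*n≢0 d t
    D≢0 : ℕ.NonZero D
    D≢0 = ℕ.m*n≢0 d (d ℕ.* t)

  N : ℤ
  N = + (d ℕ.* t) ℤ.* u ℤ.+ + 1

  coprime-dt : ℕ.Coprime ℤ.∣ N ∣ (d ℕ.* t)
  coprime-dt {g} (g∣N , g∣dt) = ℕ.∣1⇒≡1 (ℤₛ.∣⇒∣ᵤ {+ g} {+ 1} (ℤₛ.∣m+n∣m⇒∣n
    (ℤₛ.∣ᵤ⇒∣ {+ g} {N} g∣N) (ℤₛ.∣m⇒∣m*n u (ℤₛ.∣ᵤ⇒∣ {+ g} {+ (d ℕ.* t)} g∣dt))))

  coprime : ℕ.Coprime ℤ.∣ N ∣ D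
  coprime {g} (g∣N , g∣D) = coprime-dt (g∣N , ℕ.∣m⇒∣m*n t
    (ℕ.coprime-divisor (λ (h∣g , h∣dt) → coprime-dt (ℕ.∣-trans h∣g g∣N , h∣dt))
                       (subst (g ℕ.∣_) (ℕ.*-comm d (d ℕ.* t)) g∣D)))

  r : ℚ
  r = mkℚ N (ℕ.pred D) (subst (ℕ.Coprime ℤ.∣ N ∣) (≡.sym (ℕ.suc-pred D)) coprime)

  ↧r : suc (ℕ.pred D) ≡ D
  ↧r = ℕ.suc-pred D

  +D : + D ≡ + d ℤ.* + (d ℕ.* t)
  +D = ℤ.pos-* d (d ℕ.* t)

  open ℤ.≤-Reasoning

  p<r : u ℤ.* + suc (ℕ.pred D) ℤ.< N ℤ.* + d
  p<r = begin-strict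
    u ℤ.* + suc (ℕ.pred D)              ≡⟨ cong (λ z → u ℤ.* + z) ↧r ⟩
    u ℤ.* + D                           ≡⟨ cong (u ℤ.*_) +D ⟩
    u ℤ.* (+ d ℤ.* + (d ℕ.* t))         ≡⟨ lemma u (+ d) (+ (d ℕ.* t)) ⟩
    + (d ℕ.* t) ℤ.* u ℤ.* + d           <⟨ ℤ.*-monoʳ-<-pos (+ d) (i<i+1 (+ (d ℕ.* t) ℤ.* u)) ⟩
    N ℤ.* + d                           ∎
    where
    i<i+1 : ∀ i → i ℤ.< i ℤ.+ + 1
    i<i+1 i = ℤ.suc[i]≤j⇒i<j (ℤ.≤-reflexive (ℤ.+-comm (+ 1) i))
    lemma : ∀ x y z → x ℤ.* (y ℤ.* z) ≡ z ℤ.* x ℤ.* y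
    lemma = ℤ-Solver.solve-∀

  s<2^s : ∀ s → s ℕ.< 2 ℕ.^ s
  s<2^s zero    = ℕ.s≤s ℕ.z≤n
  s<2^s (suc s) = ℕ.+-mono-≤ (ℕ.m^n>0 2 s) (subst (suc s ℕ.≤_) (≡.sym (ℕ.+-identityʳ _)) (s<2^s s))

  e<dt : e ℕ.< d ℕ.* t
  e<dt = ℕ.≤-<-trans (ℕ.≤-trans (ℕ.m≤m*n e (suc n))
                       (ℕ.≤-trans (ℕ.m≤n+m _ (n ℕ.* e′)) (ℕ.m≤n+m _ (toℕ i))))
           (ℕ.<-≤-trans (s<2^s s) (ℕ.m≤n*m t d))

  r<q : N ℤ.* + e ℤ.< v ℤ.* + suc (ℕ.pred D)
  r<q = begin-strict
    N ℤ.* + e                                       ≡⟨ lemma₁ (+ (d ℕ.* t)) u (+ e) ⟩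
    (u ℤ.* + e) ℤ.* + (d ℕ.* t) ℤ.+ + e             <⟨ ℤ.+-monoʳ-< ((u ℤ.* + e) ℤ.* + (d ℕ.* t)) (ℤ.+<+ e<dt) ⟩
    (u ℤ.* + e) ℤ.* + (d ℕ.* t) ℤ.+ + (d ℕ.* t)     ≡⟨ lemma₂ (u ℤ.* + e) (+ (d ℕ.* t)) ⟩
    ℤ.suc (u ℤ.* + e) ℤ.* + (d ℕ.* t)               ≤⟨ ℤ.*-monoʳ-≤-nonNeg (+ (d ℕ.* t)) (ℤ.i<j⇒suc[i]≤j p<q) ⟩
    (v ℤ.* + d) ℤ.* + (d ℕ.* t)                     ≡⟨ ℤ.*-assoc v (+ d) (+ (d ℕ.* t)) ⟩
    v ℤ.* (+ d ℤ.* + (d ℕ.* t))                     ≡⟨ cong (v ℤ.*_) +D ⟨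
    v ℤ.* + D                                       ≡⟨ cong (λ z → v ℤ.* + z) ↧r ⟨
    v ℤ.* + suc (ℕ.pred D)                          ∎
    where
    lemma₁ : ∀ x y z → (x ℤ.* y ℤ.+ + 1) ℤ.* z ≡ (y ℤ.* z) ℤ.* x ℤ.+ z
    lemma₁ = ℤ-Solver.solve-∀
    lemma₂ : ∀ x y → x ℤ.* y ℤ.+ y ≡ (+ 1 ℤ.+ x) ℤ.* y
    lemma₂ = ℤ-Solver.solve-∀

  log-*2^ : ∀ m .{{_ : ℕ.NonZero m}} s → ⌊log₂ m ℕ.* 2 ℕ.^ s ⌋ ≡ ⌊log₂ m ⌋ ℕ.+ s
  log-*2^ m zero    = ≡.trans (cong ⌊log₂_⌋ (ℕ.*-identityʳ m)) (≡.sym (ℕ.+-identityʳ _))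
  log-*2^ m (suc s) = ≡.trans (cong ⌊log₂_⌋ (swap m (2 ℕ.^ s)))
    (≡.trans (⌊log₂[2*b]⌋≡1+⌊log₂b⌋ (m ℕ.* 2 ℕ.^ s) {{ℕ.m*n≢0 m (2 ℕ.^ s)}})
      (≡.trans (cong suc (log-*2^ m s)) (≡.sym (ℕ.+-suc _ s))))
    where
    instance
      2^s≢0 : ℕ.NonZero (2 ℕ.^ s)
      2^s≢0 = ℕ.m^n≢0 2 s
    swap : ∀ x y → x ℕ.* (2 ℕ.* y) ≡ 2 ℕ.* (x ℕ.* y)
    swap = ℕ-Solver.solve-∀

  logD : ⌊log₂ D ⌋ ≡ toℕ i ℕ.+ (e′ ℕ.+ e) ℕ.* suc n
  logD = ≡.trans (cong ⌊log₂_⌋ (≡.sym (ℕ.*-assoc d d t)))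
    (≡.trans (log-*2^ (d ℕ.* d) s) (regroup e′ (toℕ i) n e))
    where
    regroup : ∀ x y z w → x ℕ.+ (y ℕ.+ (z ℕ.* x ℕ.+ w ℕ.* suc z)) ≡ y ℕ.+ (x ℕ.+ w) ℕ.* suc z
    regroup = ℕ-Solver.solve-∀

  colour : ⌊log₂ suc (ℕ.pred D) ⌋ mod suc n ≡ i
  colour = Fin.toℕ-injective (≡.trans (Fin.toℕ-fromℕ< _)
    (≡.trans (cong (λ z → ⌊log₂ z ⌋ % suc n) ↧r)
    (≡.trans (cong (_% suc n) logD)
    (≡.trans ([m+kn]%n≡m%n (toℕ i) (e′ ℕ.+ e) (suc n)) (m<n⇒m%n≡m (Fin.toℕ<n i))))))

module _ (M : ⊛Monoid c ℓ) where
  open ⊛Monoid M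

  -- The finite nonempty set E is given by an enumeration of its elements.
  _^κ : Vec Carrier (suc n) → Carrier
  xs ^κ = π (shuffle xs)

  ShuffleTrivial : Set _
  ShuffleTrivial = ∀ {n} (xs : Vec Carrier (suc n)) → xs ^κ ≈ foldr₁ _∙_ xs

data U₁-Carrier : Set where
  𝟙 𝟘 : U₁-Carrier

U₁ : ExcludedMiddle 0ℓ → ⊛Monoid 0ℓ 0ℓ
U₁ em = record
  { setoid      = ≡.setoid U₁-Carrier
  ; π           = π
  ; π-cong      = λ {v} {w} v≅w → π-⇔ {v} {w} (to v≅w) (to (≅-sym v≅w))
  ; π-singleton = π-singleton
  ; π-concat    = λ u → π-⇔ {concat u} {map π u}
      (λ all i → π-𝟙⁺ {Word.letter u i} (λ x → all (i , x)))
      (λ all (i , x) → π-𝟙⁻ (Word.letter u i) (all i) x)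
  }
  where
  open WordEquality (≡.setoid U₁-Carrier)

  Trivial : Word U₁-Carrier → Set
  Trivial w = ∀ x → Word.letter w x ≡ 𝟙

  π : Word U₁-Carrier → U₁-Carrier
  π w = if does (em {Trivial w}) then 𝟙 else 𝟘

  π-⇔ : ∀ {v w} → (Trivial v → Trivial w) → (Trivial w → Trivial v) → π v ≡ π w
  π-⇔ {v} {w} f g =
    cong (if_then 𝟙 else 𝟘) (does-⇔ (mk⇔ f g) (em {Trivial v}) (em {Trivial w}))

  π-𝟙⁺ : ∀ {w} → Trivial w → π w ≡ 𝟙
  π-𝟙⁺ {w} all with em {Trivial w}
  ... | yes _ = refl
  ... | no ¬p = ⊥-elim (¬p all)

  π-𝟙⁻ : ∀ w → π w ≡ 𝟙 → Trivial w
  π-𝟙⁻ w eq with em {Trivial w}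
  π-𝟙⁻ w eq | yes p = p
  π-𝟙⁻ w () | no _

  to : ∀ {v w} → v ≅ w → Trivial v → Trivial w
  to {w = w} v≅w all y = ≡.trans (cong (Word.letter w) (≡.sym (strictlyInverseˡ y)))
    (≡.trans (≡.sym (letters (from y))) (all (from y)))
    where open _≅_ v≅w

  π-singleton : ∀ x → π (finite (x ∷ [])) ≡ x
  π-singleton 𝟙 = π-𝟙⁺ {finite (𝟙 ∷ [])} (λ { zero → refl })
  π-singleton 𝟘 with em {Trivial (finite (𝟘 ∷ []))}
  ... | no _  = refl
  ... | yes p with p zero
  ...   | ()

_⊛ : Pred A 0ℓ → Language A 0ℓ
(B ⊛) w = ∀ x → Word.letter w x ∈ B

data BooleanCombination {X : Set a} {I : Set b} (G : I → Pred X ℓ) : Pred X ℓ → Set (a ⊔ b ⊔ lsuc ℓ) where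
  generator    : ∀ i → BooleanCombination G (G i)
  complement   : ∀ {P} → BooleanCombination G P → BooleanCombination G (∁ P)
  intersection : ∀ {P Q} → BooleanCombination G P → BooleanCombination G Q → BooleanCombination G (P ∩ Q)
  union        : ∀ {P Q} → BooleanCombination G P → BooleanCombination G Q → BooleanCombination G (P ∪ Q)

-- Formulas over the alphabet `A` in which only the variables `Fin k` may occur;
-- a variable may be requantified.
data Formula (A : Set a) (k : ℕ) : Set a where
  _<ᶠ_      : Fin k → Fin k → Formula A k
  hasLetter : A → Fin k → Formula A k
  ¬ᶠ_       : Formula A k → Formula A k
  _∧ᶠ_ _∨ᶠ_ : Formula A k → Formula A k → Formula A k
  ∃ᶠ        : Fin k → Formula A k → Formula A k

_FreeIn_ : Fin k → Formula A k → Set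
x FreeIn (y <ᶠ z)        = x ≡ y ⊎ x ≡ z
x FreeIn (hasLetter a y) = x ≡ y
x FreeIn (¬ᶠ φ)          = x FreeIn φ
x FreeIn (φ ∧ᶠ ψ)        = x FreeIn φ ⊎ x FreeIn ψ
x FreeIn (φ ∨ᶠ ψ)        = x FreeIn φ ⊎ x FreeIn ψ
x FreeIn (∃ᶠ y φ)        = ¬ x ≡ y × x FreeIn φ

record Sentence (A : Set a) (k : ℕ) : Set a where
  field
    formula : Formula A k
    closed  : ∀ x → ¬ x FreeIn formula

-- Valuations are partial because the empty word has no positions. Atoms with an
-- unassigned variable are false, but never arise when evaluating a sentence.
module Semantics {A : Set} (w : Word A) where
  open Word w using (Pos; _<_; letter)

  Valuation : ℕ → Set
  Valuation k = Fin k → Maybe Pos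

  _[_≔_] : Valuation k → Fin k → Pos → Valuation k
  (ρ [ x ≔ p ]) y = if does (x Fin.≟ y) then just p else ρ y

  _⊨_ : Valuation k → Formula A k → Set
  ρ ⊨ (x <ᶠ y)        = ∃[ p ] ∃[ q ] ρ x ≡ just p × ρ y ≡ just q × p < q
  ρ ⊨ (hasLetter a x) = ∃[ p ] ρ x ≡ just p × letter p ≡ a
  ρ ⊨ (¬ᶠ φ)          = ¬ (ρ ⊨ φ)
  ρ ⊨ (φ ∧ᶠ ψ)        = ρ ⊨ φ × ρ ⊨ ψ
  ρ ⊨ (φ ∨ᶠ ψ)        = ρ ⊨ φ ⊎ ρ ⊨ ψ
  ρ ⊨ (∃ᶠ x φ)        = ∃[ p ] (ρ [ x ≔ p ]) ⊨ φ

models : {A : Set} → Sentence A k → Language A 0ℓ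
models φ w = Semantics._⊨_ w (λ _ → nothing) (Sentence.formula φ)

FO^_-Definable_ : ∀ k {A : Set} → Language A p → Set _
FO^_-Definable_ k {A} L = Σ (Sentence A k) λ φ → L ≐ models φ

{-# OPTIONS --safe #-}

-- Each condition is equivalent to L being invariant under replacing a word by one
-- with the same set of letters.  The substantial direction starts from a finite
-- shuffle-trivial M.  Perfect shuffles are unique (Cantor), so the product of M is
-- commutative and idempotent and x ≼ y :⇔ x ∙ y ≈ x is a semilattice order.  It
-- suffices that a nonempty word w over M with all letters ≽ e has value ≽ e.
-- Identify two positions when the factor they span has value ≽ e.  Every class has
-- value ≽ e, because its tails are ω-powers of a single value and m^ω = m.  Distinct
-- classes are never adjacent, so between two of them, after shrinking the interval
-- until each class value is absent or dense, the quotient is a perfect shuffle,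
-- whose value is ≽ e by shuffle-triviality; hence the two classes coincide.
module Submission where

open import Defs
open import Axiom.ExcludedMiddle using (ExcludedMiddle)
open import Data.Bool using (Bool; true; false; _∨_; if_then_else_)
import Data.Bool.Properties as Bool
open import Data.Empty using (⊥-elim)
open import Data.Fin using (Fin; zero; suc; finToFun; funToFin)
import Data.Fin.Properties as Fin
open import Data.List using (List; []; _∷_)
import Data.List as List
open import Data.List.Membership.Propositional using () renaming (_∈_ to _∈ₗ_)
open import Data.List.Membership.Propositional.Properties using (∈-map⁺)
open import Data.List.Relation.Unary.Any using (here; there)
open import Data.Maybe using (Maybe; just; nothing)
import Data.Maybe as Maybe
open import Data.Maybe.Properties using (just-injective)
open import Data.Nat using (ℕ; zero; suc)
import Data.Nat as ℕ
open import Data.Nat.DivMod using (_mod_)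
open import Data.Nat.Logarithm using (⌊log₂_⌋)
import Data.Nat.Properties as ℕ
open import Data.Product using (Σ; ∃-syntax; _×_; _,_; proj₁; proj₂; swap)
open import Data.Rational as ℚ using (ℚ)
import Data.Rational.Properties as ℚ
open import Data.Sum as Sum using (_⊎_; inj₁; inj₂; [_,_]′)
open import Data.Unit using (⊤; tt)
open import Data.Vec using (Vec; []; _∷_; lookup; foldr₁; tabulate)
open import Data.Vec.Properties using (lookup-replicate; lookup∘tabulate)
open import Function using (Injection; Inverse; mk↣; mk⇔; _⇔_; _∘_; flip; id)
open import Level using (Level; Lift; 0ℓ; _⊔_) renaming (suc to lsuc)
open import Relation.Binary using (Rel; Setoid; Tri; tri<; tri≈; tri>)
import Relation.Binary.Construct.Flip.EqAndOrd as Flip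
open import Relation.Binary.PropositionalEquality as ≡ using (_≡_; _≗_; cong; subst)
import Relation.Binary.Reasoning.Setoid as SetoidReasoning
open import Relation.Nullary using (¬_; yes; no; does)
open import Relation.Nullary.Decidable using (True; toWitness; fromWitness; decidable-stable; dec-true; does-⇔)
open import Relation.Unary using (Pred; _⊆_; _≐_; _∩_; _∪_; ∁; U; ｛_｝)

private
  variable
    a b c ℓ ℓ′ ℓ″ p : Level
    A : Set a

-- The lower bound suffices because `e` may be the value of another word: if `v` and `w` carry the
-- same letters, `π v` is ≼ every letter of `w`, hence ≼ `π w`, and conversely. The law m^ω = m is
-- itself a shuffle phenomenon. Write each m as the perfect shuffle of m alone; copies of that word
-- strung along any nonempty order again form a dense word without end points, which Cantor's
-- theorem collapses to a single copy. Equal ω-factors come from monotonicity: the values of growing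
-- factors descend in ≼ and therefore stabilise in a finite M. The same scheme, deciding finitely
-- many properties along a preorder as in forcing, also finds the interval on which the quotient is
-- a shuffle. Once a language is invariant, it is a property of sets of letters. Its syntactic
-- algebra consists of these sets under union, two sets being identified when no further letters
-- tell them apart.

ℕₒ : CountableOrder
ℕₒ = record
  { isStrictTotalOrder = ℕ.<-isStrictTotalOrder
  ; countable          = mk↣ {to = λ n → n} (λ eq → eq)
  }

colour : ∀ n → ℚ → Fin (suc n)
colour n q = ⌊log₂ ℚ.↧ₙ q ⌋ mod suc n

-- Subwords cut out by a predicate

module Restriction (em : ∀ {ℓ} → ExcludedMiddle ℓ) where

  byContradiction : {P : Set ℓ} → ¬ ¬ P → P
  byContradiction = decidable-stable em

  -- `True` makes membership proof-irrelevant and small.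
  Elements : {X : Set} → Pred X ℓ → Set
  Elements {X = X} P = Σ X λ x → True (em {P = P x})

  element : {X : Set} {P : Pred X ℓ} (x : X) → P x → Elements P
  element x p = x , fromWitness p

  holds : {X : Set} {P : Pred X ℓ} (x : Elements P) → P (proj₁ x)
  holds (_ , p) = toWitness p

  Elements-≡ : {X : Set} {P : Pred X ℓ} {x y : Elements P} → proj₁ x ≡ proj₁ y → x ≡ y
  Elements-≡ {x = x , _} ≡.refl = cong (x ,_) (Bool.T-irrelevant _ _)

  suborder : (I : CountableOrder) → Pred (CountableOrder.Pos I) ℓ → CountableOrder
  suborder I P = record
    { Pos                = Elements P
    ; _<_                = λ x y → proj₁ x I.< proj₁ y
    ; isStrictTotalOrder = record
      { isStrictPartialOrder = record
        { isEquivalence = ≡.isEquivalence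
        ; irrefl        = λ { ≡.refl → I.irrefl ≡.refl }
        ; trans         = I.<-trans
        ; <-resp-≈      = (λ { ≡.refl lt → lt }) , (λ { ≡.refl lt → lt })
        }
      ; compare = cmp
      }
    ; countable = mk↣ λ {x} {y} eq → Elements-≡ {x = x} {y} (Injection.injective I.countable eq)
    }
    where
    module I = CountableOrder I
    cmp : ∀ x y → Tri (proj₁ x I.< proj₁ y) (x ≡ y) (proj₁ y I.< proj₁ x)
    cmp x y with I.compare (proj₁ x) (proj₁ y)
    ... | tri< l n g = tri< l (n ∘ cong proj₁) g
    ... | tri≈ l e g = tri≈ l (Elements-≡ {x = x} {y} e) g
    ... | tri> l n g = tri> l (n ∘ cong proj₁) g

  infixl 6 _↾_
  _↾_ : (w : Word A) → Pred (Word.Pos w) ℓ → Word A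
  w ↾ P = record { dom = suborder (Word.dom w) P ; letter = Word.letter w ∘ proj₁ }

-- Cantor's theorem for words, by back-and-forth

module Cantor (em : ∀ {ℓ} → ExcludedMiddle ℓ) (S : Setoid c ℓ) where
  private module S = Setoid S
  open S using (Carrier; _≈_)
  open WordEquality S

  -- One field for each place where a back-and-forth step can ask for a new position: the matching
  -- is still empty, or the position lies left of, right of or inside it.
  record Everywhere (w : Word Carrier) (a : Carrier) : Set ℓ where
    open Word w
    field
      somewhere : ∃[ q ] letter q ≈ a
      before    : ∀ p → ∃[ q ] q < p × letter q ≈ a
      after     : ∀ p → ∃[ q ] p < q × letter q ≈ a
      between   : ∀ {p r} → p < r → ∃[ q ] p < q × q < r × letter q ≈ a

  private
    module Insertion (v w : Word Carrier) (dense : ∀ p → Everywhere w (Word.letter v p)) where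
      module v = Word v
      module w = Word w

      Pair : Set
      Pair = v.Pos × w.Pos

      infix 4 _≺_ _≺?_
      _≺_ : Pair → Pair → Set
      (p , q) ≺ (p′ , q′) = p v.< p′ × q w.< q′

      ≺-trans : ∀ {r s t} → r ≺ s → s ≺ t → r ≺ t
      ≺-trans (l , l′) (m , m′) = v.<-trans l m , w.<-trans l′ m′

      _≺?_ : Maybe Pair → Pair → Set
      nothing ≺? s = ⊤
      just r  ≺? s = r ≺ s

      Matched : Pair → Set ℓ
      Matched (p , q) = v.letter p ≈ w.letter q

      -- A finite partial isomorphism, listed in increasing order of both coordinates; the first
      -- argument is the pair just left of the list, if any.
      Sorted : Maybe Pair → List Pair → Set ℓ
      Sorted b []       = Lift ℓ ⊤
      Sorted b (r ∷ rs) = b ≺? r × Matched r × Sorted (just r) rs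

      Below : Maybe Pair → v.Pos → Set
      Below nothing  p = ⊤
      Below (just r) p = proj₁ r v.< p

      -- Walks right to the gap containing `p`, carrying the last pair passed as `b`; that pair and
      -- the next one bound the region where `w` must supply the matching letter.
      insert : ∀ b rs → Sorted b rs → ∀ p → Below b p →
               Σ (List Pair) λ rs′ → Sorted b rs′ × (∀ {r} → r ∈ₗ rs → r ∈ₗ rs′) × ∃[ q ] (p , q) ∈ₗ rs′
      insert nothing [] _ p _ with Everywhere.somewhere (dense p)
      ... | q , eq = (p , q) ∷ [] , (tt , S.sym eq , _) , (λ ()) , q , here ≡.refl
      insert (just r) [] _ p r<p with Everywhere.after (dense p) (proj₂ r)
      ... | q , lt , eq = (p , q) ∷ [] , ((r<p , lt) , S.sym eq , _) , (λ ()) , q , here ≡.refl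
      insert b (r ∷ rs) (b≺r , m , s) p b<p with v.compare p (proj₁ r)
      ... | tri≈ _ ≡.refl _ = r ∷ rs , (b≺r , m , s) , (λ i → i) , proj₂ r , here ≡.refl
      ... | tri> _ _ r<p with insert (just r) rs s p r<p
      ...   | rs′ , s′ , incl , q , i =
              r ∷ rs′ , (b≺r , m , s′) , (λ { (here e) → here e ; (there j) → there (incl j) }) , q , there i
      insert nothing (r ∷ rs) (_ , m , s) p _ | tri< p<r _ _ with Everywhere.before (dense p) (proj₂ r)
      ... | q , lt , eq = (p , q) ∷ r ∷ rs , (tt , S.sym eq , (p<r , lt) , m , s) , there , q , here ≡.refl
      insert (just b) (r ∷ rs) ((_ , b<r) , m , s) p b<p | tri< p<r _ _
        with Everywhere.between (dense p) b<r
      ... | q , lt , lt′ , eq =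
              (p , q) ∷ r ∷ rs , ((b<p , lt) , S.sym eq , (p<r , lt′) , m , s) , there , q , here ≡.refl

      matched : ∀ {b rs r} → Sorted b rs → r ∈ₗ rs → Matched r
      matched (_ , m , _) (here ≡.refl) = m
      matched (_ , _ , s) (there i)   = matched s i

      head≺ : ∀ {b rs r} → Sorted (just b) rs → r ∈ₗ rs → b ≺ r
      head≺ (b≺r , _ , _) (here ≡.refl) = b≺r
      head≺ (b≺r , _ , s) (there i)   = ≺-trans b≺r (head≺ s i)

      -- Both coordinates compare alike, so this one fact makes the limit of the stages
      -- single-valued and monotone.
      comparable : ∀ {b rs r s} → Sorted b rs → r ∈ₗ rs → s ∈ₗ rs → r ≺ s ⊎ r ≡ s ⊎ s ≺ r
      comparable _           (here ≡.refl) (here ≡.refl) = inj₂ (inj₁ ≡.refl)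
      comparable (_ , _ , s) (here ≡.refl) (there j)   = inj₁ (head≺ s j)
      comparable (_ , _ , s) (there i)   (here ≡.refl) = inj₂ (inj₂ (head≺ s i))
      comparable (_ , _ , s) (there i)   (there j)   = comparable s i j

  cantor : ∀ {v w} → (∀ p → Everywhere w (Word.letter v p)) →
           (∀ q → Everywhere v (Word.letter w q)) → v ≅ w
  cantor {v} {w} forth back = monotone-surjection f mono surj
    (λ p → VW.matched (proj₂ (stage (suc (codeᵛ p)))) (f-∈ p))
    where
    module VW = Insertion v w forth
    module WV = Insertion w v back
    open VW using (Pair; _≺_; comparable)
    open Injection (Word.countable v) using () renaming (to to codeᵛ; injective to codeᵛ-injective)
    open Injection (Word.countable w) using () renaming (to to codeʷ; injective to codeʷ-injective)

    swap-sorted : ∀ b rs → VW.Sorted b rs → WV.Sorted (Maybe.map swap b) (List.map swap rs)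
    swap-sorted b        []       _ = _
    swap-sorted nothing  (r ∷ rs) (_ , m , s) = tt , S.sym m , swap-sorted (just r) rs s
    swap-sorted (just b) (r ∷ rs) (l , m , s) = swap l , S.sym m , swap-sorted (just r) rs s

    swap-sorted′ : ∀ b rs → WV.Sorted b rs → VW.Sorted (Maybe.map swap b) (List.map swap rs)
    swap-sorted′ b        []       _ = _
    swap-sorted′ nothing  (r ∷ rs) (_ , m , s) = tt , S.sym m , swap-sorted′ (just r) rs s
    swap-sorted′ (just b) (r ∷ rs) (l , m , s) = swap l , S.sym m , swap-sorted′ (just r) rs s

    Stage : Set _
    Stage = Σ (List Pair) (VW.Sorted nothing)

    infix 4 _⊑_
    _⊑_ : Stage → Stage → Set
    (rs , _) ⊑ (rs′ , _) = ∀ {r} → r ∈ₗ rs → r ∈ₗ rs′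

    forthStep : ∀ n (X : Stage) → Σ Stage λ Y → X ⊑ Y × (∀ p → codeᵛ p ≡ n → ∃[ q ] (p , q) ∈ₗ proj₁ Y)
    forthStep n X@(rs , s) with em {P = ∃[ p ] codeᵛ p ≡ n}
    ... | no ¬p = X , (λ i → i) , λ p eq → ⊥-elim (¬p (p , eq))
    ... | yes (p , ≡.refl) with VW.insert nothing rs s p tt
    ...   | rs′ , s′ , incl , q , i =
            (rs′ , s′) , incl , λ p′ eq → q , subst (λ z → (z , q) ∈ₗ rs′) (≡.sym (codeᵛ-injective eq)) i

    backStep : ∀ n (X : Stage) → Σ Stage λ Y → X ⊑ Y × (∀ q → codeʷ q ≡ n → ∃[ p ] (p , q) ∈ₗ proj₁ Y)
    backStep n X@(rs , s) with em {P = ∃[ q ] codeʷ q ≡ n}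
    ... | no ¬q = X , (λ i → i) , λ q eq → ⊥-elim (¬q (q , eq))
    ... | yes (q , ≡.refl) with WV.insert nothing (List.map swap rs) (swap-sorted nothing rs s) q tt
    ...   | rs′ , s′ , incl , p , i =
            (List.map swap rs′ , swap-sorted′ nothing rs′ s′)
            , (λ j → ∈-map⁺ swap (incl (∈-map⁺ swap j)))
            , λ q′ eq → p , subst (λ z → (p , z) ∈ₗ List.map swap rs′) (≡.sym (codeʷ-injective eq)) (∈-map⁺ swap i)

    stage : ℕ → Stage
    stage zero    = [] , _
    stage (suc n) = proj₁ (backStep n (proj₁ (forthStep n (stage n))))

    step-⊑ : ∀ n → stage n ⊑ stage (suc n)
    step-⊑ n i = proj₁ (proj₂ (backStep n (proj₁ (forthStep n (stage n)))))
                   (proj₁ (proj₂ (forthStep n (stage n))) i)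

    stage-⊑ : ∀ {m n} → m ℕ.≤′ n → stage m ⊑ stage n
    stage-⊑ ℕ.≤′-refl         i = i
    stage-⊑ (ℕ.≤′-step {n} l) i = step-⊑ n (stage-⊑ l i)

    image : ∀ p → ∃[ q ] (p , q) ∈ₗ proj₁ (stage (suc (codeᵛ p)))
    image p with proj₂ (proj₂ (forthStep n (stage n))) p ≡.refl
      where n = codeᵛ p
    ... | q , i = q , proj₁ (proj₂ (backStep n (proj₁ (forthStep n (stage n))))) i
      where n = codeᵛ p

    preimage : ∀ q → ∃[ p ] (p , q) ∈ₗ proj₁ (stage (suc (codeʷ q)))
    preimage q = proj₂ (proj₂ (backStep n (proj₁ (forthStep n (stage n))))) q ≡.refl
      where n = codeʷ q

    compare-pairs : ∀ {m n r s} → r ∈ₗ proj₁ (stage m) → s ∈ₗ proj₁ (stage n) → r ≺ s ⊎ r ≡ s ⊎ s ≺ r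
    compare-pairs {m} {n} i j = comparable (proj₂ (stage (m ℕ.+ n)))
      (stage-⊑ (ℕ.≤⇒≤′ (ℕ.m≤m+n m n)) i) (stage-⊑ (ℕ.≤⇒≤′ (ℕ.m≤n+m n m)) j)

    f : Word.Pos v → Word.Pos w
    f p = proj₁ (image p)

    f-∈ : ∀ p → (p , f p) ∈ₗ proj₁ (stage (suc (codeᵛ p)))
    f-∈ p = proj₂ (image p)

    mono : ∀ {p p′} → Word._<_ v p p′ → Word._<_ w (f p) (f p′)
    mono {p} {p′} p<p′ with compare-pairs {suc (codeᵛ p)} {suc (codeᵛ p′)} (f-∈ p) (f-∈ p′)
    ... | inj₁ (_ , lt)        = lt
    ... | inj₂ (inj₁ eq)       = ⊥-elim (Word.irrefl v (cong proj₁ eq) p<p′)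
    ... | inj₂ (inj₂ (gt , _)) = ⊥-elim (Word.asym v p<p′ gt)

    surj : ∀ q → ∃[ p ] f p ≡ q
    surj q with preimage q
    ... | p , i with compare-pairs {suc (codeᵛ p)} {suc (codeʷ q)} (f-∈ p) i
    ...   | inj₁ (lt , _)        = ⊥-elim (Word.irrefl v ≡.refl lt)
    ...   | inj₂ (inj₁ eq)       = p , cong proj₂ eq
    ...   | inj₂ (inj₂ (lt , _)) = ⊥-elim (Word.irrefl v ≡.refl lt)

  shuffle-everywhere : ∀ {n} (xs : Vec Carrier (suc n)) i → Everywhere (shuffle xs) (lookup xs i)
  shuffle-everywhere xs i = record
    { somewhere = let (q , _ , _ , eq) = dense (below ℚ.0ℚ) in q , eq
    ; before    = λ p → let (q , _ , lt , eq) = dense (below p) in q , lt , eq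
    ; after     = λ p → let (q , lt , _ , eq) = dense (above p) in q , lt , eq
    ; between   = dense
    }
    where
    dense : ∀ {p q} → p ℚ.< q → ∃[ r ] p ℚ.< r × r ℚ.< q × Word.letter (shuffle xs) r ≈ lookup xs i
    dense lt = let (r , l , l′ , eq) = shuffle-dense xs lt i in r , l , l′ , S.reflexive eq

    above : ∀ p → p ℚ.< p ℚ.+ ℚ.1ℚ
    above p = subst (ℚ._< p ℚ.+ ℚ.1ℚ) (ℚ.+-identityʳ p) (ℚ.+-monoʳ-< p (ℚ.positive⁻¹ ℚ.1ℚ))

    below : ∀ p → p ℚ.- ℚ.1ℚ ℚ.< p
    below p = subst (p ℚ.- ℚ.1ℚ ℚ.<_) (ℚ.+-identityʳ p) (ℚ.+-monoʳ-< p (ℚ.negative⁻¹ (ℚ.- ℚ.1ℚ)))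

-- Values of factors of a word

constant : CountableOrder → A → Word A
constant I x = record { dom = I ; letter = λ _ → x }

module Values (em : ∀ {ℓ} → ExcludedMiddle ℓ) (M : ⊛Monoid c ℓ) where
  open ⊛Monoid M hiding (id)
  open Restriction em
  open WordEquality setoid using (monotone-surjection)

  module _ (w : Word Carrier) where
    open Word w using (Pos; _<_; letter)

    val : Pred Pos ℓ′ → Carrier
    val P = π (w ↾ P)

    val-cong : {P : Pred Pos ℓ′} {Q : Pred Pos ℓ″} → P ≐ Q → val P ≈ val Q
    val-cong {P = P} {Q} (P⊆Q , Q⊆P) = π-cong (monotone-surjection
      (λ x → element {P = Q} (proj₁ x) (P⊆Q (holds {P = P} x)))
      (λ lt → lt)
      (λ y → element {P = P} (proj₁ y) (Q⊆P (holds {P = Q} y)) , Elements-≡ ≡.refl)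
      (λ _ → refl))

    val-U : val U ≈ π w
    val-U = π-cong (monotone-surjection proj₁ (λ lt → lt)
      (λ y → element {P = U} y tt , ≡.refl) (λ _ → refl))

    val-singleton : ∀ x → val ｛ x ｝ ≈ letter x
    val-singleton x = trans (π-cong (monotone-surjection {v = w ↾ ｛ x ｝} {finite (letter x ∷ [])}
      (λ _ → zero)
      (λ {y} {z} lt → ⊥-elim (Word.irrefl w (≡.trans (≡.sym (holds {P = ｛ x ｝} y)) (holds {P = ｛ x ｝} z)) lt))
      (λ { zero → element {P = ｛ x ｝} x ≡.refl , ≡.refl })
      (λ y → reflexive (cong letter (≡.sym (holds {P = ｛ x ｝} y))))))
      (π-singleton (letter x))

    -- The ordering hypothesis also makes the parts disjoint, since a shared position would lie
    -- below itself. So `w ↾ P` is the concatenation of the parts, and generalized associativity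
    -- applies.
    val-partition : {P : Pred Pos ℓ′} (I : CountableOrder) (R : CountableOrder.Pos I → Pred Pos ℓ″) →
      (∀ i → R i ⊆ P) → (∀ {x} → P x → ∃[ i ] R i x) →
      (∀ {i j x y} → CountableOrder._<_ I i j → R i x → R j y → x < y) →
      val P ≈ π (record { dom = I ; letter = λ i → val (R i) })
    val-partition {P = P} I R R⊆P cover ordered =
      trans (sym (π-cong (monotone-surjection {v = concat u} {w ↾ P}
        (λ (i , x) → element {P = P} (proj₁ x) (R⊆P i (holds {P = R i} x)))
        (λ { {i , x} {j , y} (outer lt) → ordered lt (holds {P = R i} x) (holds {P = R j} y) ; (inner lt) → lt })
        (λ y → let (i , r) = cover (holds {P = P} y) in (i , element {P = R i} (proj₁ y) r) , Elements-≡ ≡.refl)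
        (λ _ → refl))))
        (π-concat u)
      where
      u : Word (Word Carrier)
      u = record { dom = I ; letter = λ i → w ↾ R i }

    val-split : {P : Pred Pos ℓ′} {Q R : Pred Pos ℓ″} → Q ⊆ P → R ⊆ P → (∀ {x} → P x → Q x ⊎ R x) →
      (∀ {x y} → Q x → R y → x < y) → val P ≈ val Q ∙ val R
    val-split {P = P} {Q} {R} Q⊆P R⊆P cover ordered = trans
      (val-partition {P = P} (Finₒ 2) part
        (λ { zero → Q⊆P ; (suc zero) → R⊆P })
        (λ p → case (cover p))
        λ { {zero} {suc zero} _ → ordered ; {zero} {zero} () ; {suc zero} {suc zero} (ℕ.s≤s ()) ; {suc zero} {zero} () })
      (π-cong (monotone-surjection (λ i → i) (λ lt → lt) (λ i → i , ≡.refl)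
        λ { zero → refl ; (suc zero) → refl }))
      where
      part : Fin 2 → Pred Pos _
      part zero    = Q
      part (suc _) = R
      case : ∀ {x} → Q x ⊎ R x → ∃[ i ] part i x
      case (inj₁ q) = zero , q
      case (inj₂ r) = suc zero , r

  val-↾ : (w : Word Carrier) (P : Pred (Word.Pos w) ℓ′) (Q : Pred (Word.Pos w) ℓ″) →
          val (w ↾ P) (Q ∘ proj₁) ≈ val w (P ∩ Q)
  val-↾ w P Q = π-cong (monotone-surjection
    (λ x → element {P = P ∩ Q} (proj₁ (proj₁ x)) (holds {P = P} (proj₁ x) , holds {P = Q ∘ proj₁} x))
    (λ lt → lt)
    (λ y → let (p , q) = holds {P = P ∩ Q} y in
      element {P = Q ∘ proj₁} (element {P = P} (proj₁ y) p) q , Elements-≡ ≡.refl)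
    (λ _ → refl))

  ∙-cong : ∀ {x x′ y y′} → x ≈ x′ → y ≈ y′ → x ∙ y ≈ x′ ∙ y′
  ∙-cong x≈x′ y≈y′ = π-cong (monotone-surjection (λ i → i) (λ lt → lt) (λ i → i , ≡.refl)
    λ { zero → x≈x′ ; (suc zero) → y≈y′ })

  -- Both bracketings are the value of the three-letter word, cut once after two letters and once
  -- after one.
  ∙-assoc : ∀ x y z → (x ∙ y) ∙ z ≈ x ∙ (y ∙ z)
  ∙-assoc x y z = begin
    (x ∙ y) ∙ z                           ≈⟨ ∙-cong (∙-cong (at zero) (at (suc zero))) (at (suc (suc zero))) ⟨
    (val w ｛ zero ｝ ∙ val w ｛ suc zero ｝) ∙ val w ｛ suc (suc zero) ｝
      ≈⟨ ∙-cong (val-split w {P = λ i → i ≡ zero ⊎ i ≡ suc zero} {｛ zero ｝} {｛ suc zero ｝}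
           (λ { ≡.refl → inj₁ ≡.refl }) (λ { ≡.refl → inj₂ ≡.refl })
           (λ { (inj₁ ≡.refl) → inj₁ ≡.refl ; (inj₂ ≡.refl) → inj₂ ≡.refl })
           (λ { ≡.refl ≡.refl → ℕ.s≤s ℕ.z≤n })) refl ⟨
    val w (λ i → i ≡ zero ⊎ i ≡ suc zero) ∙ val w ｛ suc (suc zero) ｝
      ≈⟨ val-split w {P = U} _ _
           (λ { {zero} _ → inj₁ (inj₁ ≡.refl) ; {suc zero} _ → inj₁ (inj₂ ≡.refl) ; {suc (suc zero)} _ → inj₂ ≡.refl })
           (λ { (inj₁ ≡.refl) ≡.refl → ℕ.s≤s ℕ.z≤n ; (inj₂ ≡.refl) ≡.refl → ℕ.s≤s (ℕ.s≤s ℕ.z≤n) }) ⟨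
    val w U
      ≈⟨ val-split w {P = U} _ _
           (λ { {zero} _ → inj₁ ≡.refl ; {suc zero} _ → inj₂ (inj₁ ≡.refl) ; {suc (suc zero)} _ → inj₂ (inj₂ ≡.refl) })
           (λ { ≡.refl (inj₁ ≡.refl) → ℕ.s≤s ℕ.z≤n ; ≡.refl (inj₂ ≡.refl) → ℕ.s≤s ℕ.z≤n }) ⟩
    val w ｛ zero ｝ ∙ val w (λ i → i ≡ suc zero ⊎ i ≡ suc (suc zero))
      ≈⟨ ∙-cong refl (val-split w {P = λ i → i ≡ suc zero ⊎ i ≡ suc (suc zero)} {｛ suc zero ｝} {｛ suc (suc zero) ｝}
           (λ { ≡.refl → inj₁ ≡.refl }) (λ { ≡.refl → inj₂ ≡.refl })
           (λ { (inj₁ ≡.refl) → inj₁ ≡.refl ; (inj₂ ≡.refl) → inj₂ ≡.refl })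
           (λ { ≡.refl ≡.refl → ℕ.s≤s (ℕ.s≤s ℕ.z≤n) })) ⟩
    val w ｛ zero ｝ ∙ (val w ｛ suc zero ｝ ∙ val w ｛ suc (suc zero) ｝)
      ≈⟨ ∙-cong (at zero) (∙-cong (at (suc zero)) (at (suc (suc zero)))) ⟩
    x ∙ (y ∙ z)                           ∎
    where
    open SetoidReasoning setoid
    w : Word Carrier
    w = finite (x ∷ y ∷ z ∷ [])
    at : ∀ i → val w ｛ i ｝ ≈ lookup (x ∷ y ∷ z ∷ []) i
    at = val-singleton w

-- Idempotence and commutativity from shuffle-triviality

record IsIdempotentCommutative (M : ⊛Monoid c ℓ) : Set (c ⊔ ℓ ⊔ lsuc 0ℓ) where
  open ⊛Monoid M
  field
    ∙-idem     : ∀ x → x ∙ x ≈ x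
    ∙-comm     : ∀ x y → x ∙ y ≈ y ∙ x
    π-constant : ∀ I x → CountableOrder.Pos I → π (constant I x) ≈ x

module _ (em : ∀ {ℓ} → ExcludedMiddle ℓ) {M : ⊛Monoid c ℓ} where
  open ⊛Monoid M
  open Cantor em setoid
  open WordEquality setoid using (monotone-surjection)

  -- The shuffles of (x, x) and of (x) agree at every rational; those of (x, y) and (y, x) are
  -- isomorphic by Cantor's theorem.
  shuffleTrivial⇒idempotentCommutative : ShuffleTrivial M → IsIdempotentCommutative M
  shuffleTrivial⇒idempotentCommutative trivial = record
    { ∙-idem     = λ x → trans (sym (trivial (x ∷ x ∷ []))) (trans
        (π-cong (monotone-surjection {v = shuffle (x ∷ x ∷ [])} {shuffle (x ∷ [])}
          (λ q → q) (λ lt → lt) (λ q → q , ≡.refl)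
          (λ q → reflexive (≡.trans (lookup-replicate (colour 1 q) x) (≡.sym (lookup-replicate (colour 0 q) x))))))
        (trivial (x ∷ [])))
    ; ∙-comm     = λ x y → trans (sym (trivial (x ∷ y ∷ []))) (trans
        (π-cong (cantor {shuffle (x ∷ y ∷ [])} {shuffle (y ∷ x ∷ [])}
          (flipped x y ∘ colour 1) (flipped y x ∘ colour 1)))
        (trivial (y ∷ x ∷ [])))
    ; π-constant = π-constant
    }
    where
    flipped : ∀ x y (i : Fin 2) → Everywhere (shuffle (y ∷ x ∷ [])) (lookup (x ∷ y ∷ []) i)
    flipped x y zero       = shuffle-everywhere (y ∷ x ∷ []) (suc zero)
    flipped x y (suc zero) = shuffle-everywhere (y ∷ x ∷ []) zero

    π-constant : ∀ I x → CountableOrder.Pos I → π (constant I x) ≈ x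
    π-constant I x a =
      trans (π-cong (monotone-surjection {v = constant I x} {map π blocks}
               (λ i → i) (λ lt → lt) (λ i → i , ≡.refl) (λ _ → sym (trivial (x ∷ [])))))
      (trans (sym (π-concat blocks))
      (trans (π-cong (cantor {concat blocks} {xᵑ}
               (λ (_ , q) → shuffle-everywhere (x ∷ []) (colour 0 q))
               (λ q → subst (Everywhere (concat blocks)) (≡.sym (lookup-replicate (colour 0 q) x)) everywhere)))
      (trivial (x ∷ []))))
      where
      xᵑ : Word Carrier
      xᵑ = shuffle (x ∷ [])
      blocks : Word (Word Carrier)
      blocks = constant I xᵑ
      module E = Everywhere (shuffle-everywhere (x ∷ []) zero)
      everywhere : Everywhere (concat blocks) x
      everywhere = record
        -- Here the position `a` excludes the empty order, whose product would be `id`.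
        { somewhere = let (q , eq) = E.somewhere in (a , q) , eq
        ; before    = λ (i , p) → let (q , lt , eq) = E.before p in (i , q) , inner lt , eq
        ; after     = λ (i , p) → let (q , lt , eq) = E.after p in (i , q) , inner lt , eq
        ; between   = λ
          { {i , p} (outer lt) → let (q , l , eq) = E.after p in (i , q) , inner l , outer lt , eq
          ; {i , p} (inner lt) → let (q , l , l′ , eq) = E.between lt in (i , q) , inner l , inner l′ , eq
          }
        }

-- Reversal and the opposite monoid

reverseₒ : CountableOrder → CountableOrder
reverseₒ I = record
  { _<_                = flip I._<_
  ; isStrictTotalOrder = Flip.isStrictTotalOrder I.isStrictTotalOrder
  ; countable          = I.countable
  }
  where module I = CountableOrder I

reverse : Word A → Word A
reverse w = record { dom = reverseₒ (Word.dom w) ; letter = Word.letter w }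

opposite : ⊛Monoid c ℓ → ⊛Monoid c ℓ
opposite M = record
  { setoid      = setoid
  ; π           = π ∘ reverse
  ; π-cong      = λ {v} {w} v≅w → let open _≅_ v≅w in
      π-cong (monotone-surjection to monotone (λ y → from y , strictlyInverseˡ y) letters)
  ; π-singleton = λ x → trans (π-cong (monotone-surjection {v = reverse (finite (x ∷ []))}
      (λ i → i) (λ { {zero} {zero} () }) (λ i → i , ≡.refl) (λ _ → refl))) (π-singleton x)
  ; π-concat    = λ u → trans
      (π-cong (monotone-surjection {v = reverse (concat u)} {concat (reverse (map reverse u))}
        (λ p → p) (λ { (outer lt) → outer lt ; (inner lt) → inner lt }) (λ p → p , ≡.refl) (λ _ → refl)))
      (π-concat (reverse (map reverse u)))
  }
  where
  open ⊛Monoid M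
  open WordEquality setoid using (monotone-surjection)

opposite-∙ : (M : ⊛Monoid c ℓ) → let open ⊛Monoid M in ∀ x y → ⊛Monoid._∙_ (opposite M) x y ≈ y ∙ x
opposite-∙ M x y = π-cong (monotone-surjection turn
  (λ { {zero} {zero} () ; {zero} {suc zero} () ; {suc zero} {zero} _ → ℕ.s≤s ℕ.z≤n ; {suc zero} {suc zero} (ℕ.s≤s ()) })
  (λ { zero → suc zero , ≡.refl ; (suc zero) → zero , ≡.refl })
  (λ { zero → refl ; (suc zero) → refl }))
  where
  open ⊛Monoid M
  open WordEquality setoid using (monotone-surjection)
  turn : Fin 2 → Fin 2
  turn zero       = suc zero
  turn (suc zero) = zero

-- The laws are self-dual, which is why tails are treated from these laws alone: left tails become
-- right tails of the reversed word.
opposite-idempotentCommutative : {M : ⊛Monoid c ℓ} →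
  IsIdempotentCommutative M → IsIdempotentCommutative (opposite M)
opposite-idempotentCommutative {M = M} ic = record
  { ∙-idem     = λ x → trans (opposite-∙ M x x) (∙-idem x)
  ; ∙-comm     = λ x y → trans (opposite-∙ M x y) (trans (∙-comm y x) (sym (opposite-∙ M y x)))
  ; π-constant = λ I x → π-constant (reverseₒ I) x
  }
  where
  open ⊛Monoid M
  open IsIdempotentCommutative ic

-- Linear orders and convex sets

module Order (I : CountableOrder) where
  open CountableOrder I

  infix 4 _≤_
  -- Defined by negation, so that for the reversed order it is definitionally the converse relation;
  -- `leftTail` relies on this.
  _≤_ : Rel Pos 0ℓ
  x ≤ y = ¬ y < x

  ≤-refl : ∀ {x} → x ≤ x
  ≤-refl = irrefl ≡.refl

  <⇒≤ : ∀ {x y} → x < y → x ≤ y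
  <⇒≤ = asym

  ≤-<-trans : ∀ {x y z} → x ≤ y → y < z → x < z
  ≤-<-trans {x} {y} x≤y y<z with compare x y
  ... | tri< x<y _ _    = <-trans x<y y<z
  ... | tri≈ _ ≡.refl _ = y<z
  ... | tri> _ _ y<x    = ⊥-elim (x≤y y<x)

  <-≤-trans : ∀ {x y z} → x < y → y ≤ z → x < z
  <-≤-trans {x} {y} {z} x<y y≤z with compare y z
  ... | tri< y<z _ _    = <-trans x<y y<z
  ... | tri≈ _ ≡.refl _ = x<y
  ... | tri> _ _ z<y    = ⊥-elim (y≤z z<y)

  ≤-trans : ∀ {x y z} → x ≤ y → y ≤ z → x ≤ z
  ≤-trans x≤y y≤z z<x = y≤z (<-≤-trans z<x x≤y)

  ≤-or-> : ∀ x y → x ≤ y ⊎ y < x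
  ≤-or-> x y with compare x y
  ... | tri< _ _ y≮x = inj₁ y≮x
  ... | tri≈ _ _ y≮x = inj₁ y≮x
  ... | tri> _ _ y<x = inj₂ y<x

  ≤⇒≡⊎< : ∀ {x y} → x ≤ y → x ≡ y ⊎ x < y
  ≤⇒≡⊎< {x} {y} x≤y with compare x y
  ... | tri< x<y _ _ = inj₂ x<y
  ... | tri≈ _ x≡y _ = inj₁ x≡y
  ... | tri> _ _ y<x = ⊥-elim (x≤y y<x)

  upperBound : ∀ x y → ∃[ z ] x ≤ z × y ≤ z
  upperBound x y with ≤-or-> x y
  ... | inj₁ x≤y = y , x≤y , ≤-refl
  ... | inj₂ y<x = x , ≤-refl , <⇒≤ y<x

  Convex : Pred Pos ℓ → Set ℓ
  Convex P = ∀ {x y z} → P x → P z → x < y → y < z → P y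

-- Stabilisation along a preorder

module Forcing (em : ∀ {ℓ} → ExcludedMiddle ℓ) {X : Set a} {_⊑_ : Rel X b}
               (⊑-refl : ∀ {x} → x ⊑ x) (⊑-trans : ∀ {x y z} → x ⊑ y → y ⊑ z → x ⊑ z) where
  open Restriction em using (byContradiction)

  -- The forcing alternative: beyond `x` the property is either impossible or dense.
  Settled : Pred X ℓ → Pred X _
  Settled Z x = (∀ {y} → x ⊑ y → ¬ Z y) ⊎ (∀ {y} → x ⊑ y → ∃[ z ] y ⊑ z × Z z)

  settled-⊑ : {Z : Pred X ℓ} → ∀ {x y} → x ⊑ y → Settled Z x → Settled Z y
  settled-⊑ x⊑y (inj₁ absent)    = inj₁ (absent ∘ ⊑-trans x⊑y)
  settled-⊑ x⊑y (inj₂ recurrent) = inj₂ (recurrent ∘ ⊑-trans x⊑y)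

  -- Properties are decided one at a time: if no extension excludes a property, it is already dense,
  -- and decisions persist under further extension.
  settle : ∀ {k} (Z : Fin k → Pred X ℓ) x → ∃[ y ] x ⊑ y × (∀ i → Settled (Z i) y)
  settle {k = zero}  Z x = x , ⊑-refl , λ ()
  settle {k = suc k} Z x with settle (Z ∘ suc) x
  ... | y , x⊑y , settled with em {P = ∃[ z ] y ⊑ z × (∀ {t} → z ⊑ t → ¬ Z zero t)}
  ...   | yes (z , y⊑z , absent) = z , ⊑-trans x⊑y y⊑z ,
            λ { zero → inj₁ absent ; (suc i) → settled-⊑ {Z = Z (suc i)} y⊑z (settled i) }
  ...   | no ¬absent = y , x⊑y , λ
            { zero    → inj₂ λ {z} y⊑z → byContradiction λ ¬z →
                ¬absent (z , y⊑z , λ z⊑t Zt → ¬z (_ , z⊑t , Zt))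
            ; (suc i) → settled i
            }

  -- Decide, for each i, whether `g` takes the i-th value. The value `g y` occurs at `y` itself, so
  -- it is recurrent, and monotonicity squeezes every later value between two occurrences of it.
  eventuallyConstant : {S : Setoid c ℓ} → FiniteSetoid S → let open Setoid S in
    {_≼_ : Rel Carrier ℓ′} → (∀ {x y z} → x ≼ y → y ≼ z → x ≈ z → y ≈ x) →
    (g : X → Carrier) → (∀ {x y} → x ⊑ y → g x ≼ g y) →
    ∀ x → ∃[ y ] x ⊑ y × (∀ {z} → y ⊑ z → g z ≈ g y)
  eventuallyConstant {S = S} (_ , finite) squeeze g mono x =
    let (y , x⊑y , settled) = settle (λ i z → to (g z) ≡ i) x in
    y , x⊑y , constant-from y (settled (to (g y)))
    where
    open Setoid S
    open Inverse finite using (to; from-cong; strictlyInverseʳ)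
    constant-from : ∀ y → Settled (λ z → to (g z) ≡ to (g y)) y → ∀ {z} → y ⊑ z → g z ≈ g y
    constant-from y (inj₁ absent)    _   = ⊥-elim (absent ⊑-refl ≡.refl)
    constant-from y (inj₂ recurrent) y⊑z = let (t , z⊑t , eq) = recurrent y⊑z in
      squeeze (mono y⊑z) (mono z⊑t)
        (trans (sym (strictlyInverseʳ (g y))) (trans (from-cong (≡.sym eq)) (strictlyInverseʳ (g t))))

-- The semilattice order and the tails of a word

module Semilattice (em : ∀ {ℓ} → ExcludedMiddle ℓ) {M : ⊛Monoid 0ℓ 0ℓ}
                   (ic : IsIdempotentCommutative M) where
  open ⊛Monoid M
  open Values em M
  open IsIdempotentCommutative ic

  infix 4 _≼_
  _≼_ : Rel Carrier 0ℓ
  x ≼ y = x ∙ y ≈ x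

  ≼-reflexive : ∀ {x y} → x ≈ y → x ≼ y
  ≼-reflexive {x} x≈y = trans (∙-cong refl (sym x≈y)) (∙-idem x)

  ≼-trans : ∀ {x y z} → x ≼ y → y ≼ z → x ≼ z
  ≼-trans {x} {y} {z} x≼y y≼z =
    trans (∙-cong (sym x≼y) refl) (trans (∙-assoc x y z) (trans (∙-cong refl y≼z) x≼y))

  ≼-respʳ : ∀ {x y z} → y ≈ z → x ≼ y → x ≼ z
  ≼-respʳ y≈z x≼y = ≼-trans x≼y (≼-reflexive y≈z)

  ≼-antisym : ∀ {x y} → x ≼ y → y ≼ x → x ≈ y
  ≼-antisym {x} {y} x≼y y≼x = trans (sym x≼y) (trans (∙-comm x y) y≼x)

  x∙y≼y : ∀ x y → x ∙ y ≼ y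
  x∙y≼y x y = trans (∙-assoc x y y) (∙-cong refl (∙-idem y))

  x∙y≼x : ∀ x y → x ∙ y ≼ x
  x∙y≼x x y = ≼-trans (≼-reflexive (∙-comm x y)) (x∙y≼y y x)

  ≼-∙ : ∀ {x y z} → x ≼ y → x ≼ z → x ≼ y ∙ z
  ≼-∙ {x} {y} {z} x≼y x≼z = trans (sym (∙-assoc x y z)) (trans (∙-cong x≼y refl) x≼z)

  ≼-foldr₁ : ∀ {n x} (xs : Vec Carrier (suc n)) → (∀ i → x ≼ lookup xs i) → x ≼ foldr₁ _∙_ xs
  ≼-foldr₁ (y ∷ [])     x≼ = x≼ zero
  ≼-foldr₁ (y ∷ z ∷ ys) x≼ = ≼-∙ (x≼ zero) (≼-foldr₁ (z ∷ ys) (x≼ ∘ suc))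

  module _ (w : Word Carrier) where
    open Word w using (Pos; dom; _<_; compare; letter)
    open Order dom

    -- Convexity makes `Q` a product before · `P` · after, and a product is ≼ each of its factors.
    val-anti : {P Q : Pred Pos 0ℓ} → Convex P → P ⊆ Q → val w Q ≼ val w P
    val-anti {P} {Q} convex P⊆Q =
      ≼-trans (≼-reflexive (val-split w {P = Q} {Before} {P ∪ After} proj₁
        (λ { (inj₁ p) → P⊆Q p ; (inj₂ (q , _)) → q }) split₁
        λ { (_ , _ , b) (inj₁ p) → b p ; (_ , ¬p , b) (inj₂ (_ , _ , ¬b)) → before<after b ¬b }))
      (≼-trans (x∙y≼y _ _)
      (≼-trans (≼-reflexive (val-split w {P = P ∪ After} {P} {After} inj₁ inj₂ (λ z → z)
        (λ p (_ , ¬p , ¬b) → P<after p ¬p ¬b)))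
      (x∙y≼x _ _)))
      where
      open Restriction em using (byContradiction)
      Before After : Pred Pos 0ℓ
      Before x = Q x × ¬ P x × (∀ {y} → P y → x < y)
      -- A mere negation, so that the two sets exhaust `Q` outside `P`. Convexity of `P` places
      -- `After` above all of `P`; if `P` is empty, everything falls into `Before`.
      After x  = Q x × ¬ P x × ¬ (∀ {y} → P y → x < y)

      witness : ∀ {x} → ¬ (∀ {y} → P y → x < y) → ∃[ y ] P y × y ≤ x
      witness ¬b = byContradiction λ none → ¬b λ p → byContradiction λ ≮ → none (_ , p , ≮)

      split₁ : ∀ {x} → Q x → Before x ⊎ (P ∪ After) x
      split₁ {x} q with em {P = P x} | em {P = ∀ {y} → P y → x < y}
      ... | yes p | _     = inj₂ (inj₁ p)
      ... | no ¬p | yes b = inj₁ (q , ¬p , b)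
      ... | no ¬p | no ¬b = inj₂ (inj₂ (q , ¬p , ¬b))

      P<after : ∀ {x y} → P x → ¬ P y → ¬ (∀ {z} → P z → y < z) → x < y
      P<after {x} {y} p ¬p ¬b with compare x y
      ... | tri< x<y _ _ = x<y
      ... | tri≈ _ ≡.refl _ = ⊥-elim (¬p p)
      ... | tri> _ _ y<x with witness ¬b
      ...   | z , pz , z≤y with ≤⇒≡⊎< z≤y
      ...     | inj₁ ≡.refl = ⊥-elim (¬p pz)
      ...     | inj₂ z<y    = ⊥-elim (¬p (convex pz p z<y y<x))

      before<after : ∀ {x y} → (∀ {z} → P z → x < z) → ¬ (∀ {z} → P z → y < z) → x < y
      before<after b ¬b = let (z , p , z≤y) = witness ¬b in <-≤-trans (b p) z≤y

    [_,_] [_,_⟩ : Pos → Pos → Pred Pos 0ℓ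
    [ i , j ] x = i ≤ x × x ≤ j
    [ i , j ⟩ x = i ≤ x × x < j

    [_,∞⟩ ⟨∞,_] : Pos → Pred Pos 0ℓ
    [ i ,∞⟩ x = i ≤ x
    ⟨∞, j ] x = x ≤ j

    -- A cofinal sequence cuts a tail of w into ω factors, chosen so that all of
    -- them have the same value m; the tail then has value m^ω = m.
    module _ (finite : IsFinite M) {e : Carrier} (bounded : ∀ {i j} → i ≤ j → e ≼ val w [ i , j ]) where
      private
        module Unbounded (next : Pos → Pos) (<-next : ∀ x → x < next x) where
          open Forcing em {X = Pos} {_⊑_ = _≤_} ≤-refl ≤-trans
          open Injection (Word.countable w) using () renaming (to to code; injective to code-injective)

          [i,j⟩-convex : ∀ i j → Convex [ i , j ⟩
          [i,j⟩-convex i j (i≤x , _) (_ , z<j) x<y y<z = ≤-trans i≤x (<⇒≤ x<y) , Word.<-trans w y<z z<j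

          val-[⟩ : ∀ {i i′ j j′} → i ≤ i′ → j′ ≤ j → val w [ i , j ⟩ ≼ val w [ i′ , j′ ⟩
          val-[⟩ {i′ = i′} {j′ = j′} i≤i′ j′≤j = val-anti ([i,j⟩-convex i′ j′)
            λ (i′≤x , x<j′) → ≤-trans i≤i′ i′≤x , <-≤-trans x<j′ j′≤j

          -- Lengthening the factor to the right lowers its value, so the value stabilises; starting
          -- the search at `next i` keeps the factor nonempty.
          stable : ∀ i → ∃[ j ] next i ≤ j × (∀ {z} → j ≤ z → val w [ i , z ⟩ ≈ val w [ i , j ⟩)
          stable i = eventuallyConstant {S = setoid} finite {_≼_ = flip _≼_}
            (λ y≼x z≼y x≈z → ≼-antisym y≼x (≼-trans (≼-reflexive x≈z) z≼y))
            (λ z → val w [ i , z ⟩) (val-[⟩ ≤-refl) (next i)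

          limit : Pos → Carrier
          limit i = val w [ i , proj₁ (stable i) ⟩

          limit-reached : ∀ i {j} → proj₁ (stable i) ≤ j → val w [ i , j ⟩ ≈ limit i
          limit-reached i = proj₂ (proj₂ (stable i))

          -- Beyond both stabilisation points the two limits are values of nested factors.
          limit-mono : ∀ {i j} → i ≤ j → limit i ≼ limit j
          limit-mono {i} {j} i≤j = let (z , l , l′) = upperBound (proj₁ (stable i)) (proj₁ (stable j)) in
            ≼-trans (≼-reflexive (sym (limit-reached i l)))
              (≼-respʳ (limit-reached j l′) (val-[⟩ i≤j ≤-refl))

          module _ (i₀ : Pos) where
            -- A second stabilisation, now in the starting point: from `i₁` on, all sufficiently
            -- long factors share one value.
            stableLimit : ∃[ i ] i₀ ≤ i × (∀ {z} → i ≤ z → limit z ≈ limit i)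
            stableLimit = eventuallyConstant {S = setoid} finite {_≼_ = _≼_}
              (λ x≼y y≼z x≈z → ≼-antisym (≼-respʳ (sym x≈z) y≼z) x≼y) limit limit-mono i₀

            i₁ : Pos
            i₁ = proj₁ stableLimit

            m : Carrier
            m = limit i₁

            -- The cuts become cofinal by passing the position coded `n` at step `n`; if `n` codes
            -- no position, `i₀` is a harmless default.
            beyond : ∀ n → ∃[ y ] (∀ x → code x ≡ n → x < y)
            beyond n with em {P = ∃[ x ] code x ≡ n}
            ... | yes (x , eq) = next x , λ x′ eq′ →
                    subst (_< next x) (code-injective (≡.trans eq (≡.sym eq′))) (<-next x)
            ... | no ¬x        = i₀ , λ x eq → ⊥-elim (¬x (x , eq))

            step : ∀ n i → ∃[ j ] proj₁ (stable i) ≤ j × (∀ x → code x ≡ n → x < j)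
            step n i = let (j , l , l′) = upperBound (proj₁ (stable i)) (proj₁ (beyond n)) in
              j , l , λ x eq → <-≤-trans (proj₂ (beyond n) x eq) l′

            cut : ℕ → Pos
            cut zero    = i₁
            cut (suc n) = proj₁ (step n (cut n))

            cut-step : ∀ n → cut n < cut (suc n)
            cut-step n = <-≤-trans (<-next (cut n))
              (≤-trans (proj₁ (proj₂ (stable (cut n)))) (proj₁ (proj₂ (step n (cut n)))))

            cut-mono : ∀ {m n} → m ℕ.≤′ n → cut m ≤ cut n
            cut-mono ℕ.≤′-refl         = ≤-refl
            cut-mono (ℕ.≤′-step {n} l) = ≤-trans (cut-mono l) (<⇒≤ (cut-step n))

            block-value : ∀ n → val w [ cut n , cut (suc n) ⟩ ≈ m
            block-value n = trans (limit-reached (cut n) (proj₁ (proj₂ (step n (cut n)))))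
              (proj₂ (proj₂ stableLimit) (cut-mono (ℕ.≤⇒≤′ (ℕ.z≤n {n}))))

            block : ∀ n {x} → i₁ ≤ x → x < cut n → ∃[ k ] [ cut k , cut (suc k) ⟩ x
            block zero    i₁≤x x<i₁ = ⊥-elim (i₁≤x x<i₁)
            block (suc n) {x} i₁≤x x<cut with ≤-or-> (cut n) x
            ... | inj₁ cut≤x = n , cut≤x , x<cut
            ... | inj₂ x<cut′ = block n i₁≤x x<cut′

            val-[i₁,∞⟩ : val w [ i₁ ,∞⟩ ≈ m
            val-[i₁,∞⟩ = trans
              (val-partition w ℕₒ (λ n → [ cut n , cut (suc n) ⟩)
                (λ n (cut≤x , _) → ≤-trans (cut-mono (ℕ.≤⇒≤′ (ℕ.z≤n {n}))) cut≤x)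
                -- A position coded c lies below cut number c + 1, so the downward search for its
                -- block starts there.
                (λ {x} i₁≤x → block (suc (code x)) i₁≤x (proj₂ (proj₂ (step (code x) (cut (code x)))) x ≡.refl))
                (λ k<l (_ , x<cut) (cut≤y , _) → <-≤-trans x<cut (≤-trans (cut-mono (ℕ.≤⇒≤′ k<l)) cut≤y)))
              (trans (π-cong (monotone-surjection {w = constant ℕₒ m} (λ n → n) (λ lt → lt) (λ n → n , ≡.refl) block-value))
                (π-constant ℕₒ m 0))
              where open WordEquality setoid using (monotone-surjection)

            good-[⟩ : ∀ {i j} → i < j → e ≼ val w [ i , j ⟩
            good-[⟩ {i} {j} i<j = ≼-trans (bounded (<⇒≤ i<j))
              (val-anti ([i,j⟩-convex i j) λ (i≤x , x<j) → i≤x , <⇒≤ x<j)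

            good-m : e ≼ m
            good-m = good-[⟩ (<-≤-trans (<-next i₁) (proj₁ (proj₂ (stable i₁))))

            -- The ω-power covers the tail from `i₁` only; the stretch from `i₀` to `i₁` is part of
            -- a closed interval.
            good-[i₀,∞⟩ : e ≼ val w [ i₀ ,∞⟩
            good-[i₀,∞⟩ with ≤⇒≡⊎< (proj₁ (proj₂ stableLimit))
            ... | inj₁ i₀≡i₁ = subst (λ i → e ≼ val w [ i ,∞⟩) (≡.sym i₀≡i₁) (≼-respʳ (sym val-[i₁,∞⟩) good-m)
            ... | inj₂ i₀<i₁ = ≼-respʳ
              (sym (val-split w {Q = [ i₀ , i₁ ⟩} {[ i₁ ,∞⟩} proj₁ (≤-trans (<⇒≤ i₀<i₁))
                (λ {x} i₀≤x → split (≤-or-> i₁ x) i₀≤x) (λ (_ , x<i₁) i₁≤y → <-≤-trans x<i₁ i₁≤y)))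
              (≼-∙ (good-[⟩ i₀<i₁) (≼-respʳ (sym val-[i₁,∞⟩) good-m))
              where
              split : ∀ {x} → i₁ ≤ x ⊎ x < i₁ → i₀ ≤ x → [ i₀ , i₁ ⟩ x ⊎ i₁ ≤ x
              split (inj₁ i₁≤x) _    = inj₂ i₁≤x
              split (inj₂ x<i₁) i₀≤x = inj₁ (i₀≤x , x<i₁)

      -- A last position turns the tail into a closed interval; otherwise every position has a
      -- larger one, as the cofinal sequence requires.
      rightTail : ∀ i → e ≼ val w [ i ,∞⟩
      rightTail i with em {P = ∃[ j ] ∀ x → x ≤ j}
      ... | yes (j , max) = ≼-respʳ (val-cong w (proj₁ , λ i≤x → i≤x , max _)) (bounded (max i))
      ... | no ¬max = Unbounded.good-[i₀,∞⟩ (proj₁ ∘ next) (proj₂ ∘ next) i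
        where
        open Restriction em using (byContradiction)
        next : ∀ x → ∃[ y ] x < y
        next x = byContradiction λ none → ¬max (x , λ y x<y → none (y , x<y))

module _ (em : ∀ {ℓ} → ExcludedMiddle ℓ) {M : ⊛Monoid 0ℓ 0ℓ} (ic : IsIdempotentCommutative M) where
  open ⊛Monoid M
  open IsIdempotentCommutative ic
  open Values em M
  open Semilattice em ic
  private
    ic⁻ : IsIdempotentCommutative (opposite M)
    ic⁻ = opposite-idempotentCommutative ic
    module S⁻ = Semilattice em ic⁻
    module V⁻ = Values em (opposite M)

  private
    ≼⇒≼⁻ : ∀ {x y} → x ≼ y → x S⁻.≼ y
    ≼⇒≼⁻ {x} {y} x≼y = trans (opposite-∙ M x y) (trans (∙-comm y x) x≼y)

    ≼⁻⇒≼ : ∀ {x y} → x S⁻.≼ y → x ≼ y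
    ≼⁻⇒≼ {x} {y} x≼y = trans (∙-comm x y) (trans (sym (opposite-∙ M x y)) x≼y)

    val-reverse : (w : Word Carrier) (P : Pred (Word.Pos w) 0ℓ) → val w P ≈ V⁻.val (reverse w) P
    val-reverse w P = π-cong (monotone-surjection (λ x → x) (λ lt → lt) (λ x → x , ≡.refl) (λ _ → refl))
      where open WordEquality setoid using (monotone-surjection)

  -- This is `rightTail` for the reversed word in the opposite monoid; by commutativity both monoids
  -- have the same order ≼.
  leftTail : IsFinite M → ∀ {e} (w : Word Carrier) → let open Order (Word.dom w) in
    (∀ {i j} → i ≤ j → e ≼ val w ([_,_] w i j)) → ∀ j → e ≼ val w (⟨∞,_] w j)
  leftTail finite {e} w bounded j =
    ≼-respʳ (sym (val-reverse w _)) (≼⁻⇒≼ (S⁻.rightTail (reverse w) finite {e}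
      (λ {i} {j} j≤i → S⁻.≼-respʳ (trans (val-cong w (swap , swap)) (val-reverse w _)) (≼⇒≼⁻ (bounded j≤i))) j))

-- Condensation of a word whose letters are bounded below

module Condensation (em : ∀ {ℓ} → ExcludedMiddle ℓ) {M : ⊛Monoid 0ℓ 0ℓ}
                    (finite : IsFinite M) (trivial : ShuffleTrivial M) where
  open ⊛Monoid M
  open Restriction em
  open Values em M
  open Cantor em setoid
  private
    ic : IsIdempotentCommutative M
    ic = shuffleTrivial⇒idempotentCommutative em trivial
  open Semilattice em ic public

  everywhere-resp : ∀ {w x y} → x ≈ y → Everywhere w x → Everywhere w y
  everywhere-resp x≈y E = record
    { somewhere = let (q , eq) = somewhere in q , trans eq x≈y
    ; before    = λ p → let (q , lt , eq) = before p in q , lt , trans eq x≈y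
    ; after     = λ p → let (q , lt , eq) = after p in q , lt , trans eq x≈y
    ; between   = λ lt → let (q , l , l′ , eq) = between lt in q , l , l′ , trans eq x≈y
    }
    where open Everywhere E

  module _ (w : Word Carrier) {e : Carrier} (e≼letter : ∀ x → e ≼ Word.letter w x) where
    open Word w using (Pos; dom; _<_; compare; letter; irrefl; asym; <-trans)
    open Order dom

    Good : Pred Pos 0ℓ → Set
    Good P = e ≼ val w P

    good-⊆ : ∀ {P Q} → Convex P → P ⊆ Q → Good Q → Good P
    good-⊆ convex P⊆Q good = ≼-trans good (val-anti w convex P⊆Q)

    -- The two pieces of `P` need only be contained in good sets, since goodness passes to convex
    -- subsets.
    good-cover : ∀ {P P₁ P₂} (D : Pred Pos 0ℓ) → (∀ {x y} → D y → x < y → D x) → Convex P →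
                 (∀ {x} → P x → D x → P₁ x) → (∀ {x} → P x → ¬ D x → P₂ x) →
                 Good P₁ → Good P₂ → Good P
    good-cover {P} D down convex ⊆₁ ⊆₂ good₁ good₂ = ≼-respʳ
      (sym (val-split w {P = P} {P ∩ D} {P ∩ ∁ D} proj₁ proj₁ split λ (_ , d) (_ , ¬d) → D<∁D d ¬d))
      (≼-∙ (good-⊆ (λ (p , _) (q , d) l l′ → convex p q l l′ , down d l′) (λ (p , d) → ⊆₁ p d) good₁)
           (good-⊆ (λ (p , ¬d) (q , _) l l′ → convex p q l l′ , λ d → ¬d (down d l)) (λ (p , ¬d) → ⊆₂ p ¬d) good₂))
      where
      split : ∀ {x} → P x → (P ∩ D) x ⊎ (P ∩ ∁ D) x
      split {x} p with em {P = D x}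
      ... | yes d = inj₁ (p , d)
      ... | no ¬d = inj₂ (p , ¬d)
      D<∁D : ∀ {x y} → D x → ¬ D y → x < y
      D<∁D {x} {y} d ¬d with compare x y
      ... | tri< x<y _ _    = x<y
      ... | tri≈ _ ≡.refl _ = ⊥-elim (¬d d)
      ... | tri> _ _ y<x    = ⊥-elim (¬d (down d y<x))

    good-singleton : ∀ x → Good ｛ x ｝
    good-singleton x = ≼-respʳ (sym (val-singleton w x)) (e≼letter x)

    -- The closed interval between two positions in whichever order they come, so that `_~_` is
    -- symmetric without a case distinction.
    Hull : Pos → Pos → Pred Pos 0ℓ
    Hull i j x = (i ≤ x ⊎ j ≤ x) × (x ≤ i ⊎ x ≤ j)

    hull-convex : ∀ i j → Convex (Hull i j)
    hull-convex i j (lower , _) (_ , upper) x<y y<z = raise lower , drop upper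
      where
      raise : _ → _
      raise (inj₁ l) = inj₁ (≤-trans l (<⇒≤ x<y))
      raise (inj₂ l) = inj₂ (≤-trans l (<⇒≤ x<y))
      drop : _ → _
      drop (inj₁ l) = inj₁ (≤-trans (<⇒≤ y<z) l)
      drop (inj₂ l) = inj₂ (≤-trans (<⇒≤ y<z) l)

    hull-lower : ∀ {i j x} → i ≤ j → Hull i j x → i ≤ x
    hull-lower i≤j (inj₁ i≤x , _) = i≤x
    hull-lower i≤j (inj₂ j≤x , _) = ≤-trans i≤j j≤x

    hull-upper : ∀ {i j x} → i ≤ j → Hull i j x → x ≤ j
    hull-upper i≤j (_ , inj₁ x≤i) = ≤-trans x≤i i≤j
    hull-upper i≤j (_ , inj₂ x≤j) = x≤j

    infix 4 _~_
    _~_ : Rel Pos 0ℓ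
    i ~ j = Good (Hull i j)

    ~-refl : ∀ {i} → i ~ i
    ~-refl {i} = good-⊆ (hull-convex i i)
      (λ h → point (hull-lower ≤-refl h) (hull-upper ≤-refl h)) (good-singleton i)
      where
      point : ∀ {x} → i ≤ x → x ≤ i → i ≡ x
      point i≤x x≤i with ≤⇒≡⊎< i≤x
      ... | inj₁ i≡x = i≡x
      ... | inj₂ i<x = ⊥-elim (x≤i i<x)

    ~-sym : ∀ {i j} → i ~ j → j ~ i
    ~-sym {i} {j} = good-⊆ (hull-convex j i) λ (l , u) → Sum.swap l , Sum.swap u

    private
      -- Cut at `j`, wherever it lies: the lower piece is in the hull of `i` and `j`, the upper
      -- piece in that of `j` and `k`.
      ~-trans-< : ∀ {i j k} → i < k → i ~ j → j ~ k → i ~ k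
      ~-trans-< {i} {j} {k} i<k i~j j~k = good-cover (_≤ j)
        (λ y≤j x<y → ≤-trans (<⇒≤ x<y) y≤j) (hull-convex i k)
        (λ h x≤j → inj₁ (hull-lower (<⇒≤ i<k) h) , inj₂ x≤j)
        (λ h ¬x≤j → inj₁ (λ x<j → ¬x≤j (<⇒≤ x<j)) , inj₂ (hull-upper (<⇒≤ i<k) h))
        i~j j~k

    ~-trans : ∀ {i j k} → i ~ j → j ~ k → i ~ k
    ~-trans {i} {j} {k} i~j j~k with compare i k
    ... | tri< i<k _ _    = ~-trans-< i<k i~j j~k
    ... | tri≈ _ ≡.refl _ = ~-refl
    ... | tri> _ _ k<i    = ~-sym (~-trans-< k<i (~-sym j~k) (~-sym i~j))

    class-convex : ∀ r → Convex (r ~_)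
    class-convex r {x} {y} {z} r~x r~z x<y y<z = ~-trans r~x
      (good-⊆ (hull-convex x y)
        (λ h → inj₁ (hull-lower (<⇒≤ x<y) h) , inj₂ (≤-trans (hull-upper (<⇒≤ x<y) h) (<⇒≤ y<z)))
        (~-trans (~-sym r~x) r~z))

    -- Cut at `r`. The tail lemmas apply to the class read as a word of its own, because any two of
    -- its positions are equivalent.
    good-class : ∀ r → Good (r ~_)
    good-class r = good-cover (_≤ r) (λ y≤r x<y → ≤-trans (<⇒≤ x<y) y≤r) (class-convex r)
      (λ r~x x≤r → r~x , x≤r) (λ r~x ¬x≤r → r~x , λ x<r → ¬x≤r (<⇒≤ x<r))
      (≼-respʳ (val-↾ w (r ~_) (_≤ r)) (leftTail em ic finite (w ↾ (r ~_)) (λ {i} {j} → bounded {i} {j}) r′))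
      (≼-respʳ (val-↾ w (r ~_) (r ≤_)) (rightTail (w ↾ (r ~_)) finite (λ {i} {j} → bounded {i} {j}) r′))
      where
      r′ : Elements (r ~_)
      r′ = element {P = r ~_} r ~-refl
      bounded : ∀ {i j : Elements (r ~_)} → proj₁ i ≤ proj₁ j → e ≼ val (w ↾ (r ~_)) ([_,_] (w ↾ (r ~_)) i j)
      bounded {i} {j} i≤j = ≼-respʳ (sym (val-↾ w (r ~_) ([_,_] w (proj₁ i) (proj₁ j))))
        (good-⊆ (λ (r~x , i≤x , _) (r~z , _ , z≤j) x<y y<z →
                  class-convex r r~x r~z x<y y<z , ≤-trans i≤x (<⇒≤ x<y) , ≤-trans (<⇒≤ y<z) z≤j)
          (λ (_ , i≤x , x≤j) → inj₁ i≤x , inj₂ x≤j)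
          (~-trans (~-sym (holds {P = r ~_} i)) (holds {P = r ~_} j)))

    -- The classes lying strictly between those of c and d.
    Between : Pos → Pos → Pred Pos 0ℓ
    Between c d x = c < x × x < d × ¬ c ~ x × ¬ d ~ x

    -- From `c` to `d` there come a part of the class of `c`, then whole classes, then a part of the
    -- class of `d`; the end pieces are good because classes are.
    merge : ∀ {c d} → c < d → Good (Between c d) → c ~ d
    merge {c} {d} c<d good = good-cover D₁ down₁ (hull-convex c d)
      (λ { h (inj₁ x<c) → ⊥-elim (hull-lower (<⇒≤ c<d) h x<c) ; _ (inj₂ c~x) → c~x })
      (λ h ¬d₁ → h , ¬d₁) (good-class c)
      (good-cover D₂ down₂ (λ (h , ¬d₁) (h′ , _) l l′ → hull-convex c d h h′ l l′ , λ d₁ → ¬d₁ (down₁ d₁ l))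
        (λ (h , ¬d₁) (x<d , ¬d~x) → above (hull-lower (<⇒≤ c<d) h) ¬d₁ , x<d , ¬d₁ ∘ inj₂ , ¬d~x)
        (λ (h , _) ¬d₂ → inClass (hull-upper (<⇒≤ c<d) h) ¬d₂)
        good (good-class d))
      where
      D₁ D₂ : Pred Pos 0ℓ
      -- The alternative `x < c` is void inside the hull; it makes `D₁` closed downwards.
      D₁ x = x < c ⊎ c ~ x
      D₂ x = x < d × ¬ d ~ x

      down₁ : ∀ {x y} → D₁ y → x < y → D₁ x
      down₁ (inj₁ y<c) x<y = inj₁ (<-trans x<y y<c)
      down₁ {x} (inj₂ c~y) x<y with compare x c
      ... | tri< x<c _ _    = inj₁ x<c
      ... | tri≈ _ ≡.refl _ = inj₂ ~-refl
      ... | tri> _ _ c<x    = inj₂ (class-convex c ~-refl c~y c<x x<y)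

      down₂ : ∀ {x y} → D₂ y → x < y → D₂ x
      down₂ (y<d , ¬d~y) x<y = <-trans x<y y<d , λ d~x → ¬d~y (class-convex d d~x ~-refl x<y y<d)

      above : ∀ {x} → c ≤ x → ¬ D₁ x → c < x
      above c≤x ¬d₁ with ≤⇒≡⊎< c≤x
      ... | inj₁ ≡.refl = ⊥-elim (¬d₁ (inj₂ ~-refl))
      ... | inj₂ c<x    = c<x

      inClass : ∀ {x} → x ≤ d → ¬ D₂ x → d ~ x
      inClass x≤d ¬d₂ with ≤⇒≡⊎< x≤d
      ... | inj₁ ≡.refl = ~-refl
      ... | inj₂ x<d    = byContradiction λ ¬d~x → ¬d₂ (x<d , ¬d~x)

    -- Adjacent classes would merge: an empty set between them is good, being contained in a
    -- singleton.
    between-nonempty : ∀ {c d} → c < d → ¬ c ~ d → ∃[ x ] Between c d x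
    between-nonempty {c} {d} c<d ¬c~d = byContradiction λ none → ¬c~d (merge c<d
      (good-⊆ (λ p _ _ _ → ⊥-elim (none (_ , p))) (λ p → ⊥-elim (none (_ , p))) (good-singleton c)))

    between-class : ∀ {c d r x} → Between c d r → r ~ x → Between c d x
    between-class {c} {d} {r} {x} (c<r , r<d , ¬c~r , ¬d~r) r~x =
      c<x , x<d , (λ c~x → ¬c~r (~-trans c~x (~-sym r~x))) , (λ d~x → ¬d~r (~-trans d~x (~-sym r~x)))
      where
      c<x : c < x
      c<x with compare x c
      ... | tri< x<c _ _    = ⊥-elim (¬c~r (~-sym (class-convex r r~x ~-refl x<c c<r)))
      ... | tri≈ _ ≡.refl _ = ⊥-elim (¬c~r (~-sym r~x))
      ... | tri> _ _ c<x    = c<x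
      x<d : x < d
      x<d with compare x d
      ... | tri< x<d _ _    = x<d
      ... | tri≈ _ ≡.refl _ = ⊥-elim (¬d~r (~-sym r~x))
      ... | tri> _ _ d<x    = ⊥-elim (¬d~r (~-sym (class-convex r ~-refl r~x r<d d<x)))

    between-⊆ : ∀ {c c′ d d′} → c ≤ c′ → d′ ≤ d → Between c′ d′ ⊆ Between c d
    between-⊆ {c} {c′} {d} {d′} c≤c′ d′≤d {x} (c′<x , x<d′ , ¬c′~x , ¬d′~x) =
      ≤-<-trans c≤c′ c′<x , <-≤-trans x<d′ d′≤d , ¬c~x , ¬d~x
      where
      ¬c~x : ¬ c ~ x
      ¬c~x c~x with ≤⇒≡⊎< c≤c′
      ... | inj₁ ≡.refl = ¬c′~x c~x
      ... | inj₂ c<c′   = ¬c′~x (~-trans (~-sym (class-convex c ~-refl c~x c<c′ c′<x)) c~x)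
      ¬d~x : ¬ d ~ x
      ¬d~x d~x with ≤⇒≡⊎< d′≤d
      ... | inj₁ ≡.refl = ¬d′~x d~x
      ... | inj₂ d′<d   = ¬d′~x (~-trans (~-sym (class-convex d d~x ~-refl x<d′ d′<d)) d~x)

    open Injection (Word.countable w) using () renaming (to to code; injective to code-injective)

    -- The member of least code stands for its class, so the quotient is again a suborder of the
    -- positions and inherits their countability.
    IsRepresentative : Pred Pos 0ℓ
    IsRepresentative r = ∀ x → r ~ x → code r ℕ.≤ code x

    representative : ∀ x → ∃[ r ] x ~ r × IsRepresentative r
    representative x = search (code x) x ℕ.≤-refl
      where
      search : ∀ n x → code x ℕ.≤ n → ∃[ r ] x ~ r × IsRepresentative r
      search n x code≤n with em {P = ∃[ y ] x ~ y × code y ℕ.< code x}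
      ... | no ¬smaller = x , ~-refl , λ y x~y → ℕ.≮⇒≥ λ lt → ¬smaller (y , x~y , lt)
      search zero    x code≤n | yes (y , x~y , lt) = ⊥-elim (ℕ.n≮0 (ℕ.<-≤-trans lt code≤n))
      search (suc n) x code≤n | yes (y , x~y , lt) =
        let (r , y~r , rep) = search n y (ℕ.≤-pred (ℕ.<-≤-trans lt code≤n)) in r , ~-trans x~y y~r , rep

    representative-unique : ∀ {r s} → IsRepresentative r → IsRepresentative s → r ~ s → r ≡ s
    representative-unique rep rep′ r~s = code-injective (ℕ.≤-antisym (rep _ r~s) (rep′ _ (~-sym r~s)))

    Representative : Pos → Pos → Pred Pos 0ℓ
    Representative c d r = IsRepresentative r × Between c d r

    quotient : Pos → Pos → Word Carrier
    quotient c d = record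
      { dom    = suborder dom (Representative c d)
      ; letter = λ r → val w (proj₁ r ~_)
      }

    val-between : ∀ c d → val w (Between c d) ≈ π (quotient c d)
    val-between c d = val-partition w (suborder dom (Representative c d)) (λ r → proj₁ r ~_)
      (λ r → between-class (proj₂ (rep r)))
      (λ {x} b → let (r , x~r , isRep) = representative x in
        element {P = Representative c d} r (isRep , between-class b x~r) , ~-sym x~r)
      (λ {r} {s} r<s r~x s~y → ordered r<s
        (λ r~s → irrefl (representative-unique (proj₁ (rep r)) (proj₁ (rep s)) r~s) r<s) r~x s~y)
      where
      rep : ∀ (r : Elements (Representative c d)) → Representative c d (proj₁ r)
      rep = holds {P = Representative c d}

      ordered : ∀ {r s x y} → r < s → ¬ r ~ s → r ~ x → s ~ y → x < y
      ordered {r} {s} {x} {y} r<s ¬r~s r~x s~y with compare x s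
      ... | tri≈ _ ≡.refl _ = ⊥-elim (¬r~s r~x)
      ... | tri> _ _ s<x    = ⊥-elim (¬r~s (class-convex r ~-refl r~x r<s s<x))
      ... | tri< x<s _ _ with compare x y
      ...   | tri< x<y _ _    = x<y
      ...   | tri≈ _ ≡.refl _ = ⊥-elim (¬r~s (~-trans r~x (~-sym s~y)))
      ...   | tri> _ _ y<x    = ⊥-elim (¬r~s (~-trans r~x (~-sym (class-convex s s~y ~-refl y<x x<s))))

    private
      Interval : Set
      Interval = Σ (Pos × Pos) λ (c , d) → c < d × ¬ c ~ d

      infix 4 _⊑_
      _⊑_ : Rel Interval 0ℓ
      ((c , d) , _) ⊑ ((c′ , d′) , _) = c ≤ c′ × d′ ≤ d

      open Inverse (proj₂ finite) using (from-cong) renaming (to to index; strictlyInverseʳ to index-inverse)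
      open Forcing em {X = Interval} {_⊑_ = _⊑_} (≤-refl , ≤-refl)
        (λ (l , u) (l′ , u′) → ≤-trans l l′ , ≤-trans u′ u)

      value : Pos → Carrier
      value r = val w (r ~_)

      index-injective : ∀ {x y} → index x ≡ index y → x ≈ y
      index-injective {x} {y} eq =
        trans (sym (index-inverse x)) (trans (from-cong eq) (index-inverse y))

      Occurs : Fin (proj₁ finite) → Pred Interval 0ℓ
      Occurs a ((c , d) , _) = ∃[ r ] Representative c d r × index (value r) ≡ a

      -- Where each class value is either absent or dense, the quotient is a perfect shuffle.
      module _ {c d : Pos} (c<d : c < d) (¬c~d : ¬ c ~ d)
               (settled : ∀ a → Settled (Occurs a) ((c , d) , c<d , ¬c~d)) where
        X : Interval
        X = (c , d) , c<d , ¬c~d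

        Q : Word Carrier
        Q = quotient c d

        -- The position `r` shows that its value is not absent, hence it is recurrent. Any two
        -- inequivalent positions inside the interval bound a refinement of it, in which the value
        -- must occur again.
        value-everywhere : ∀ r → Representative c d r → Everywhere Q (value r)
        value-everywhere r rep = record
          { somewhere = let (s , _ , _ , eq) = occurrence c<d ¬c~d ≤-refl ≤-refl in s , eq
          ; before    = λ p → let (_ , c<p , p<d , ¬c~p , _) = holds {P = Representative c d} p
                                  (s , _ , s<p , eq) = occurrence c<p ¬c~p ≤-refl (<⇒≤ p<d)
                              in s , s<p , eq
          ; after     = λ p → let (_ , c<p , p<d , _ , ¬d~p) = holds {P = Representative c d} p
                                  (s , p<s , _ , eq) = occurrence p<d (¬d~p ∘ ~-sym) (<⇒≤ c<p) ≤-refl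
                              in s , p<s , eq
          ; between   = λ {p} {q} p<q →
              let (repₚ , c<p , _ , _) = holds {P = Representative c d} p
                  (repᵩ , _ , q<d , _) = holds {P = Representative c d} q
              in occurrence p<q (λ p~q → irrefl (representative-unique repₚ repᵩ p~q) p<q) (<⇒≤ c<p) (<⇒≤ q<d)
          }
          where
          found : Settled (Occurs (index (value r))) X → ∀ Y → X ⊑ Y → Occurs (index (value r)) Y
          found (inj₁ absent)    Y X⊑Y = ⊥-elim (absent {X} (≤-refl , ≤-refl) (r , rep , ≡.refl))
          found (inj₂ recurrent) Y X⊑Y with recurrent {Y} X⊑Y
          ... | _ , (l , u) , (s , (isRep , b) , eq) = s , (isRep , between-⊆ l u b) , eq

          occurrence : ∀ {i j} → i < j → ¬ i ~ j → c ≤ i → j ≤ d →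
                       Σ (Word.Pos Q) λ s → i < proj₁ s × proj₁ s < j × value (proj₁ s) ≈ value r
          occurrence {i} {j} i<j ¬i~j c≤i j≤d
            with found (settled (index (value r))) ((i , j) , i<j , ¬i~j) (c≤i , j≤d)
          ... | s , (isRep , b@(i<s , s<j , _)) , eq =
            element {P = Representative c d} s (isRep , between-⊆ c≤i j≤d b) , i<s , s<j , index-injective eq

        -- Each index needs an entry in the shuffle. An index that is absent gets `r₀` as a filler,
        -- and its condition on `s` is then void.
        pick : ∀ r₀ → Representative c d r₀ → ∀ a → Settled (Occurs a) X →
               Σ Pos λ r → Representative c d r × (∀ {s} → Representative c d s → index (value s) ≡ a → value r ≈ value s)
        pick r₀ rep₀ a (inj₁ absent)    =
          r₀ , rep₀ , λ rep eq → ⊥-elim (absent {X} (≤-refl , ≤-refl) (_ , rep , eq))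
        pick r₀ rep₀ a (inj₂ recurrent) with recurrent {X} (≤-refl , ≤-refl)
        ... | _ , (l , u) , (r , (isRep , b) , eq) =
          r , (isRep , between-⊆ l u b) , λ _ eq′ → index-injective (≡.trans eq (≡.sym eq′))

        module _ (r₀ : Pos) (rep₀ : Representative c d r₀) where
          -- The extra first entry `r₀` makes the vector visibly nonempty.
          pickAt : Fin (suc (proj₁ finite)) → ∃[ r ] Representative c d r
          pickAt zero    = r₀ , rep₀
          pickAt (suc a) = let (r , rep , _) = pick r₀ rep₀ a (settled a) in r , rep

          values : Vec Carrier (suc (proj₁ finite))
          values = tabulate (value ∘ proj₁ ∘ pickAt)

          lookup-values : ∀ i → lookup values i ≈ value (proj₁ (pickAt i))
          lookup-values i = reflexive (lookup∘tabulate (value ∘ proj₁ ∘ pickAt) i)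

          quotient≅shuffle : WordEquality._≅_ setoid Q (shuffle values)
          quotient≅shuffle = cantor
            (λ p → let rep = holds {P = Representative c d} p
                       a   = index (value (proj₁ p))
                       (_ , _ , same) = pick r₀ rep₀ a (settled a)
                   in everywhere-resp {w = shuffle values} (trans (lookup-values (suc a)) (same rep ≡.refl))
                        (shuffle-everywhere values (suc a)))
            (λ q → let i = colour (proj₁ finite) q
                       (r , rep) = pickAt i
                   in everywhere-resp {w = Q} (sym (lookup-values i)) (value-everywhere r rep))

          good-between : Good (Between c d)
          good-between = ≼-respʳ
            (trans (sym (trivial values)) (trans (sym (π-cong quotient≅shuffle)) (sym (val-between c d))))
            (≼-foldr₁ values λ i → ≼-respʳ (sym (lookup-values i)) (good-class (proj₁ (pickAt i))))

      no-interval : ¬ Interval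
      no-interval X₀ with settle Occurs X₀
      ... | ((c , d) , c<d , ¬c~d) , _ , settled =
        let (x , b)          = between-nonempty c<d ¬c~d
            (r , x~r , isRep) = representative x
        in ¬c~d (merge c<d (good-between c<d ¬c~d settled r (isRep , between-class b x~r)))

    ~-total : ∀ i j → i ~ j
    ~-total i j with compare i j
    ... | tri< i<j _ _    = byContradiction λ ¬i~j → no-interval ((i , j) , i<j , ¬i~j)
    ... | tri≈ _ ≡.refl _ = ~-refl
    ... | tri> _ _ j<i    = ~-sym (byContradiction λ ¬j~i → no-interval ((j , i) , j<i , ¬j~i))

    π-lowerBound : Pos → e ≼ π w
    π-lowerBound i = ≼-respʳ (trans (val-cong w {P = i ~_} {U} (_ , λ {x} _ → ~-total i x)) (val-U w)) (good-class i)

  letter-upperBound : ∀ (w : Word Carrier) x → π w ≼ Word.letter w x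
  letter-upperBound w x = ≼-trans (≼-reflexive (sym (val-U w)))
    (≼-respʳ (val-singleton w x)
      (val-anti w {｛ x ｝} {U} (λ { ≡.refl ≡.refl x<y y<x → ⊥-elim (Word.asym w x<y y<x) }) _))

  private
    π-≼ : ∀ (v w : Word Carrier) → Word.Pos w → (∀ y → ∃[ x ] Word.letter v x ≈ Word.letter w y) → π v ≼ π w
    π-≼ v w i v∋w = π-lowerBound w (λ y → let (x , eq) = v∋w y in ≼-respʳ eq (letter-upperBound v x)) i

  π-content : ∀ (v w : Word Carrier) →
              (∀ y → ∃[ x ] Word.letter v x ≈ Word.letter w y) →
              (∀ x → ∃[ y ] Word.letter w y ≈ Word.letter v x) → π v ≈ π w
  π-content v w v∋w w∋v with em {P = Word.Pos v}
  ... | yes i = ≼-antisym (π-≼ v w (proj₁ (w∋v i)) v∋w) (π-≼ w v i w∋v)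
  ... | no ¬i = π-cong (WordEquality.monotone-surjection setoid (λ x → ⊥-elim (¬i x))
                  (λ {x} _ → ⊥-elim (¬i x)) (λ y → ⊥-elim (¬i (proj₁ (v∋w y)))) (λ x → ⊥-elim (¬i x)))

-- Languages that depend only on the set of letters

SameContent : Word A → Word A → Set _
SameContent v w = (∀ x → ∃[ y ] Word.letter w y ≡ Word.letter v x)
                × (∀ y → ∃[ x ] Word.letter v x ≡ Word.letter w y)

ContentInvariant : {A : Set a} → Language A p → Set _
ContentInvariant L = ∀ {v w} → SameContent v w → L v → L w

morphism-letters : {M : ⊛Monoid c ℓ} (h : Morphism (free A) M) → let open Morphism h; open ⊛Monoid M in
                   ∀ w → ⟦ w ⟧ ≈ π (map (λ x → ⟦ finite (x ∷ []) ⟧) w)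
morphism-letters {A = A} {M = M} h w = trans
  (⟦⟧-cong (WordEquality.monotone-surjection (≡.setoid A) {w} {concat (map singleton w)}
    (λ x → x , zero) outer (λ { (x , zero) → x , ≡.refl }) (λ _ → ≡.refl)))
  (homo (map singleton w))
  where
  open Morphism h
  open ⊛Monoid M
  singleton : A → Word A
  singleton x = finite (x ∷ [])

-- Stated for any monoid whose product depends only on the set of letters, to serve finite
-- shuffle-trivial monoids and powers of `U₁` alike.
recognizes⇒invariant : {A : Set a} {L : Language A p} {M : ⊛Monoid c ℓ} → let open ⊛Monoid M in
  (∀ v w → (∀ y → ∃[ x ] Word.letter v x ≈ Word.letter w y) →
           (∀ x → ∃[ y ] Word.letter w y ≈ Word.letter v x) → π v ≈ π w) →
  M Recognizes L → ContentInvariant L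
recognizes⇒invariant {M = M} π-content (h , L⊆ , ⊆L) {v} {w} (v⊆w , w⊆v) v∈L =
  let (u , u∈L , eq) = L⊆ v∈L in ⊆L (u , u∈L , trans (sym same) eq)
  where
  open Morphism h
  open ⊛Monoid M
  same : ⟦ v ⟧ ≈ ⟦ w ⟧
  same = trans (morphism-letters h v) (trans
    (π-content _ _
      (λ y → let (x , eq) = w⊆v y in x , reflexive (cong (λ z → ⟦ finite (z ∷ []) ⟧) eq))
      (λ x → let (y , eq) = v⊆w x in y , reflexive (cong (λ z → ⟦ finite (z ∷ []) ⟧) eq)))
    (sym (morphism-letters h w)))

extend : {A : Set a} (M : ⊛Monoid c ℓ) → (A → ⊛Monoid.Carrier M) → Morphism (free A) M
extend M f = record
  { ⟦_⟧     = λ w → π (map f w)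
  ; ⟦⟧-cong = λ v≅w → π-cong (record
      { bijection = WordEquality._≅_.bijection v≅w
      ; monotone  = WordEquality._≅_.monotone v≅w
      ; letters   = reflexive ∘ cong f ∘ WordEquality._≅_.letters v≅w
      })
  ; homo    = λ u → π-concat (map (map f) u)
  }
  where open ⊛Monoid M

-- A finite setoid needs an enumeration without repetitions up to `_≈_`; excluded middle removes the
-- repetitions.
finiteQuotient : (∀ {ℓ} → ExcludedMiddle ℓ) → (S : Setoid c ℓ) → let open Setoid S in
                 ∀ {m} (f : Fin m → Carrier) → (∀ x → ∃[ i ] f i ≈ x) → FiniteSetoid S
finiteQuotient em S f onto = let (k , g , g-injective , f⊆g) = distinct f in
  k , record
    { to        = λ x → proj₁ (index x f⊆g)
    ; from      = g
    ; to-cong   = λ {x} {y} x≈y → g-injective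
        (trans (proj₂ (index x f⊆g)) (trans x≈y (sym (proj₂ (index y f⊆g)))))
    ; from-cong = reflexive ∘ cong g
    ; inverse   = (λ {i} {x} x≈gi → g-injective (trans (proj₂ (index x f⊆g)) x≈gi))
                , (λ { {x} ≡.refl → proj₂ (index x f⊆g) })
    }
  where
  open Setoid S
  distinct : ∀ {m} (f : Fin m → Carrier) → ∃[ k ] Σ (Fin k → Carrier) λ g →
             (∀ {i j} → g i ≈ g j → i ≡ j) × (∀ i → ∃[ j ] g j ≈ f i)
  distinct {zero}  f = 0 , (λ ()) , (λ { {()} }) , λ ()
  distinct {suc m} f with distinct (f ∘ suc)
  ... | k , g , g-injective , f⊆g with em {P = ∃[ j ] g j ≈ f zero}
  ...   | yes old = k , g , g-injective , λ { zero → old ; (suc i) → f⊆g i }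
  ...   | no new  = suc k , g′ , injective , λ { zero → zero , refl ; (suc i) → let (j , eq) = f⊆g i in suc j , eq }
    where
    g′ : Fin (suc k) → Carrier
    g′ zero    = f zero
    g′ (suc j) = g j
    injective : ∀ {i j} → g′ i ≈ g′ j → i ≡ j
    injective {zero}  {zero}  _  = ≡.refl
    injective {zero}  {suc j} eq = ⊥-elim (new (j , sym eq))
    injective {suc i} {zero}  eq = ⊥-elim (new (i , eq))
    injective {suc i} {suc j} eq = cong suc (g-injective eq)

  index : ∀ {k} {g : Fin k → Carrier} x → (∀ i → ∃[ j ] g j ≈ f i) → ∃[ j ] g j ≈ x
  index x f⊆g = let (i , eq) = onto x ; (j , eq′) = f⊆g i in j , trans eq′ eq

-- Invariance of one-variable sentences

module _ {A : Set} where

  module _ {v w : Word A} where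
    SameValuation : Semantics.Valuation v 1 → Semantics.Valuation w 1 → Set
    SameValuation ρ σ = (ρ zero ≡ nothing × σ zero ≡ nothing)
      ⊎ (∃[ x ] ∃[ y ] ρ zero ≡ just x × σ zero ≡ just y × Word.letter v x ≡ Word.letter w y)

  -- With a single variable an order atom compares a position with itself and fails, and a
  -- quantifier discards the previous position, so only letters have to agree. Negation exchanges
  -- the words, hence the two-sided `SameContent`.
  transfer : ∀ {v w : Word A} (φ : Formula A 1) {ρ σ} → SameContent v w →
             SameValuation {v} {w} ρ σ → Semantics._⊨_ v ρ φ → Semantics._⊨_ w σ φ
  transfer {v} (zero <ᶠ zero) _ _ (p , q , eq , eq′ , p<q) =
    ⊥-elim (Word.irrefl v (just-injective (≡.trans (≡.sym eq) eq′)) p<q)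
  transfer (hasLetter a zero) _ (inj₁ (none , _)) (p , eq , _) with () ← ≡.trans (≡.sym eq) none
  transfer {v} (hasLetter a zero) _ (inj₂ (x , y , ρx , σy , same)) (p , eq , letter≡a) =
    y , σy , ≡.trans (≡.sym same) (≡.trans (cong (Word.letter v) (just-injective (≡.trans (≡.sym ρx) eq))) letter≡a)
  transfer {v} {w} (¬ᶠ φ) {ρ} {σ} content same ¬φ = ¬φ ∘ transfer φ (swap content) (flipped same)
    where
    flipped : SameValuation {v} {w} ρ σ → SameValuation {w} {v} σ ρ
    flipped (inj₁ none)                   = inj₁ (swap none)
    flipped (inj₂ (x , y , ρx , σy , eq)) = inj₂ (y , x , σy , ρx , ≡.sym eq)
  transfer (φ ∧ᶠ ψ) content same (l , r) = transfer φ content same l , transfer ψ content same r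
  transfer (φ ∨ᶠ ψ) content same (inj₁ l) = inj₁ (transfer φ content same l)
  transfer (φ ∨ᶠ ψ) content same (inj₂ r) = inj₂ (transfer ψ content same r)
  transfer (∃ᶠ zero φ) content _ (x , ⊨φ) = let (y , eq) = proj₁ content x in
    y , transfer φ content (inj₂ (x , y , ≡.refl , ≡.refl , ≡.sym eq)) ⊨φ

  definable⇒invariant : {L : Language A p} → FO^ 1 -Definable L → ContentInvariant L
  definable⇒invariant (φ , L⊆ , ⊆L) content v∈L =
    ⊆L (transfer (Sentence.formula φ) content (inj₁ (≡.refl , ≡.refl)) (L⊆ v∈L))

-- Sentences, products and boolean combinations over a finite alphabet

module Invariance (em : ∀ {ℓ} → ExcludedMiddle ℓ) {A : Set} (finiteA : Finite A) where
  open Restriction em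
  private
    n : ℕ
    n = proj₁ finiteA
    open Inverse (proj₂ finiteA) using () renaming (to to index; from to letterAt; strictlyInverseʳ to letterAt-index)

  ⌊_⌋ : Set ℓ → Bool
  ⌊ P ⌋ = does (em {P = P})

  ⌊⌋⁺ : {P : Set ℓ} → P → ⌊ P ⌋ ≡ true
  ⌊⌋⁺ {P = P} = dec-true (em {P = P})

  ⌊⌋⁻ : {P : Set ℓ} → ⌊ P ⌋ ≡ true → P
  ⌊⌋⁻ {P = P} eq with em {P = P}
  ... | yes p = p
  ⌊⌋⁻ () | no _

  ⌊⌋-cong : {P Q : Set ℓ} → (P → Q) → (Q → P) → ⌊ P ⌋ ≡ ⌊ Q ⌋
  ⌊⌋-cong f g = does-⇔ (mk⇔ f g) em em

  ≡true-ext : ∀ {b b′} → (b ≡ true → b′ ≡ true) → (b′ ≡ true → b ≡ true) → b ≡ b′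
  ≡true-ext {true}  f g = ≡.sym (f ≡.refl)
  ≡true-ext {false} {true}  f g = g ≡.refl
  ≡true-ext {false} {false} f g = ≡.refl

  module Definability where
    module _ (B : Pred A 0ℓ) where
      -- `zero <ᶠ zero` serves as the false formula; the disjunction over all letters then says that
      -- the letter at hand lies outside `B`.
      excluded : A → Formula A 1
      excluded x = if ⌊ B x ⌋ then zero <ᶠ zero else hasLetter x zero

      someExcluded : ∀ {m} → (Fin m → A) → Formula A 1
      someExcluded {zero}  f = zero <ᶠ zero
      someExcluded {suc m} f = excluded (f zero) ∨ᶠ someExcluded (f ∘ suc)

      module _ (w : Word A) (x : Word.Pos w) where
        open Semantics w
        ρ : Valuation 1
        ρ = (λ _ → nothing) [ zero ≔ x ]

        ⊭false : ¬ ρ ⊨ (zero <ᶠ zero)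
        ⊭false (p , q , ≡.refl , ≡.refl , p<p) = Word.irrefl w ≡.refl p<p

        excluded⁻ : ∀ y → ρ ⊨ excluded y → ¬ B (Word.letter w x)
        excluded⁻ y ⊨e b with em {P = B y}
        ... | yes _ = ⊭false ⊨e
        ... | no ¬b with ⊨e
        ...   | (_ , ≡.refl , ≡.refl) = ¬b b

        excluded⁺ : ¬ B (Word.letter w x) → ρ ⊨ excluded (Word.letter w x)
        excluded⁺ ¬b with em {P = B (Word.letter w x)}
        ... | yes b = ⊥-elim (¬b b)
        ... | no _  = x , ≡.refl , ≡.refl

        someExcluded⁻ : ∀ {m} (f : Fin m → A) → ρ ⊨ someExcluded f → ¬ B (Word.letter w x)
        someExcluded⁻ {zero}  f ⊨e        = ⊥-elim (⊭false ⊨e)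
        someExcluded⁻ {suc m} f (inj₁ ⊨e) = excluded⁻ (f zero) ⊨e
        someExcluded⁻ {suc m} f (inj₂ ⊨e) = someExcluded⁻ (f ∘ suc) ⊨e

        someExcluded⁺ : ∀ {m} (f : Fin m → A) i → f i ≡ Word.letter w x → ¬ B (Word.letter w x) →
                        ρ ⊨ someExcluded f
        someExcluded⁺ f zero    eq ¬b = inj₁ (subst (λ y → ρ ⊨ excluded y) (≡.sym eq) (excluded⁺ ¬b))
        someExcluded⁺ f (suc i) eq ¬b = inj₂ (someExcluded⁺ (f ∘ suc) i eq ¬b)

    combination⇒sentence : {P : Language A 0ℓ} → BooleanCombination _⊛ P → Σ (Sentence A 1) λ φ → P ≐ models φ
    combination⇒sentence (generator B) =
      record { formula = ¬ᶠ (∃ᶠ zero (someExcluded B letterAt)) ; closed = λ { zero (x≢x , _) → x≢x ≡.refl } }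
      , (λ {w} all (x , ⊨e) → someExcluded⁻ B w x letterAt ⊨e (all x))
      , (λ {w} none x → byContradiction λ ¬b →
          none (x , someExcluded⁺ B w x letterAt (index (Word.letter w x)) (letterAt-index _) ¬b))
    combination⇒sentence (complement P) = let (φ , ⊆ , ⊇) = combination⇒sentence P in
      record { formula = ¬ᶠ (Sentence.formula φ) ; closed = Sentence.closed φ }
      , (λ ¬p → ¬p ∘ ⊇) , (λ ¬φ → ¬φ ∘ ⊆)
    combination⇒sentence (intersection P Q) =
      let (φ , ⊆ , ⊇) = combination⇒sentence P ; (ψ , ⊆′ , ⊇′) = combination⇒sentence Q in
      record
        { formula = Sentence.formula φ ∧ᶠ Sentence.formula ψ
        ; closed  = λ { x (inj₁ i) → Sentence.closed φ x i ; x (inj₂ i) → Sentence.closed ψ x i }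
        }
      , (λ (p , q) → ⊆ p , ⊆′ q) , (λ (p , q) → ⊇ p , ⊇′ q)
    combination⇒sentence (union P Q) =
      let (φ , ⊆ , ⊇) = combination⇒sentence P ; (ψ , ⊆′ , ⊇′) = combination⇒sentence Q in
      record
        { formula = Sentence.formula φ ∨ᶠ Sentence.formula ψ
        ; closed  = λ { x (inj₁ i) → Sentence.closed φ x i ; x (inj₂ i) → Sentence.closed ψ x i }
        }
      , Sum.map ⊆ ⊆′ , Sum.map ⊇ ⊇′

  content : Word A → A → Bool
  content w x = ⌊ ∃[ i ] Word.letter w i ≡ x ⌋

  content-≗⇒same : ∀ {v w} → content v ≗ content w → SameContent v w
  content-≗⇒same eq =
    (λ x → ⌊⌋⁻ (≡.trans (≡.sym (eq _)) (⌊⌋⁺ (x , ≡.refl)))) ,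
    (λ y → ⌊⌋⁻ (≡.trans (eq _) (⌊⌋⁺ (y , ≡.refl))))

  same⇒content-≗ : ∀ {v w} → SameContent v w → content v ≗ content w
  same⇒content-≗ (v⊆w , w⊆v) x = ⌊⌋-cong
    (λ (i , eq) → let (j , eq′) = v⊆w i in j , ≡.trans eq′ eq)
    (λ (j , eq) → let (i , eq′) = w⊆v j in i , ≡.trans eq′ eq)

  -- A canonical word for each set of letters, spelled in the order of the enumeration; through it
  -- an invariant language becomes a property of such sets.
  wordOf : (A → Bool) → Word A
  wordOf C = record
    { dom    = suborder (Finₒ n) (λ i → C (letterAt i) ≡ true)
    ; letter = letterAt ∘ proj₁
    }

  content-wordOf : ∀ C → content (wordOf C) ≗ C
  content-wordOf C x = ≡true-ext
    (λ eq → let (i , i≡x) = ⌊⌋⁻ eq in subst (λ y → C y ≡ true) i≡x (holds {P = λ i → C (letterAt i) ≡ true} i))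
    (λ eq → ⌊⌋⁺ (element {P = λ i → C (letterAt i) ≡ true} (index x)
                   (subst (λ y → C y ≡ true) (≡.sym (letterAt-index x)) eq) , letterAt-index x))

  module U₁-Product where
    module U = ⊛Monoid (U₁ em)

    π-trivial : ∀ {v w} → ((∀ x → Word.letter v x ≡ 𝟙) → ∀ y → Word.letter w y ≡ 𝟙) →
                ((∀ y → Word.letter w y ≡ 𝟙) → ∀ x → Word.letter v x ≡ 𝟙) → U.π v ≡ U.π w
    π-trivial f g = cong (if_then 𝟙 else 𝟘) (⌊⌋-cong f g)

    π-trivial⁻ : ∀ {v w} → U.π v ≡ U.π w → (∀ x → Word.letter v x ≡ 𝟙) → ∀ y → Word.letter w y ≡ 𝟙
    π-trivial⁻ {v} {w} eq all = ⌊⌋⁻ (is𝟙 (≡.trans (≡.sym eq) (cong (if_then 𝟙 else 𝟘) (⌊⌋⁺ all))))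
      where
      is𝟙 : ∀ {b} → (if b then 𝟙 else 𝟘) ≡ 𝟙 → b ≡ true
      is𝟙 {true} _ = ≡.refl

    power-content : ∀ k (v w : Word (⊛Monoid.Carrier (U₁ em ^ k))) → let open ⊛Monoid (U₁ em ^ k) in
                    (∀ y → ∃[ x ] Word.letter v x ≈ Word.letter w y) →
                    (∀ x → ∃[ y ] Word.letter w y ≈ Word.letter v x) → π v ≈ π w
    power-content k v w w⊆v v⊆w i = π-trivial {map (λ x → x i) v} {map (λ x → x i) w}
      (λ all y → let (x , eq) = w⊆v y in ≡.trans (≡.sym (eq i)) (all x))
      (λ all x → let (y , eq) = v⊆w x in ≡.trans (≡.sym (eq i)) (all y))

    -- Only the i-th letter puts `𝟘` in coordinate `i`, so in the image of a word that coordinate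
    -- records whether the letter occurs.
    mark : A → Fin n → U₁-Carrier
    mark x i = if ⌊ letterAt i ≡ x ⌋ then 𝟘 else 𝟙

    mark-𝟙⁺ : ∀ {x i} → ¬ letterAt i ≡ x → mark x i ≡ 𝟙
    mark-𝟙⁺ {x} {i} ≢ with em {P = letterAt i ≡ x}
    ... | yes eq = ⊥-elim (≢ eq)
    ... | no _   = ≡.refl

    mark-𝟙⁻ : ∀ {x i} → mark x i ≡ 𝟙 → ¬ letterAt i ≡ x
    mark-𝟙⁻ {x} {i} eq with em {P = letterAt i ≡ x}
    mark-𝟙⁻ () | yes _
    mark-𝟙⁻ _  | no ≢ = ≢

    contentMorphism : Morphism (free A) (U₁ em ^ n)
    contentMorphism = extend (U₁ em ^ n) mark
    open Morphism contentMorphism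

    ⟦⟧-≈⇒⊆ : ∀ {v w} → ⊛Monoid._≈_ (U₁ em ^ n) ⟦ v ⟧ ⟦ w ⟧ → ∀ y → ∃[ x ] Word.letter v x ≡ Word.letter w y
    ⟦⟧-≈⇒⊆ {v} {w} eq y = byContradiction λ none →
      mark-𝟙⁻ (π-trivial⁻ {map (λ x → mark x i) v} {map (λ x → mark x i) w} (eq i)
        (λ x → mark-𝟙⁺ λ eq′ → none (x , ≡.trans (≡.sym eq′) (letterAt-index _))) y)
        (letterAt-index _)
      where i = index (Word.letter w y)

  module _ {L : Language A p} (inv : ContentInvariant L) where
    accepts : (A → Bool) → Bool
    accepts C = ⌊ L (wordOf C) ⌋

    accepts-content : ∀ {C w} → C ≗ content w → (L w → accepts C ≡ true) × (accepts C ≡ true → L w)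
    accepts-content {C} {w} eq =
      let same : SameContent (wordOf C) w
          same = content-≗⇒same {wordOf C} {w} λ x → ≡.trans (content-wordOf C x) (eq x)
      in (λ w∈L → ⌊⌋⁺ (inv {w} {wordOf C} (swap same) w∈L)) , (λ acc → inv {wordOf C} {w} same (⌊⌋⁻ acc))

    accepts-cong : ∀ {C D} → C ≗ D → accepts C ≡ accepts D
    accepts-cong {C} {D} eq = ⌊⌋-cong (inv {wordOf C} {wordOf D} same) (inv {wordOf D} {wordOf C} (swap same))
      where
      same : SameContent (wordOf C) (wordOf D)
      same = content-≗⇒same {wordOf C} {wordOf D} λ x →
        ≡.trans (content-wordOf C x) (≡.trans (eq x) (≡.sym (content-wordOf D x)))

    invariant⇒product : Σ ℕ λ k → (U₁ em ^ k) Recognizes L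
    invariant⇒product = n , contentMorphism
      , (λ {w} w∈L → w , w∈L , λ _ → ≡.refl)
      , (λ {w} (v , v∈L , eq) → inv {v} {w} (⟦⟧-≈⇒⊆ {w} {v} eq , ⟦⟧-≈⇒⊆ {v} {w} (≡.sym ∘ eq)) v∈L)
      where open U₁-Product

    invariant⇒combination : ∃[ P ] BooleanCombination _⊛ P × L ≐ P
    invariant⇒combination =
      let (P , comb , P-spec) = decisionTree letterAt (λ v → accepts (λ x → lookup v (index x))) in
      P , comb
      , (λ {w} w∈L → proj₂ (P-spec w) (proj₁ (accepts-content {w = w} (tabulated w)) w∈L))
      , (λ {w} w∈P → proj₂ (accepts-content {w = w} (tabulated w)) (proj₁ (P-spec w) w∈P))
      where
      tabulated : ∀ w x → lookup (tabulate (content w ∘ letterAt)) (index x) ≡ content w x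
      tabulated w x = ≡.trans (lookup∘tabulate _ (index x)) (cong (content w) (letterAt-index x))

      -- Truth at the leaves of the decision tree: `BooleanCombination` has no constants, but `U ⊛`
      -- contains every word.
      full : BooleanCombination _⊛ (U ⊛)
      full = generator U

      Contains : A → Language A 0ℓ
      Contains x = ∁ ((λ y → ¬ y ≡ x) ⊛)

      contains : ∀ x → BooleanCombination _⊛ (Contains x)
      contains x = complement (generator λ y → ¬ y ≡ x)

      -- Shannon expansion: branch on whether the next letter occurs and specialise `accept`
      -- accordingly.
      decisionTree : ∀ {m} (f : Fin m → A) (accept : Vec Bool m → Bool) → Σ (Language A 0ℓ) λ P →
        BooleanCombination _⊛ P × (∀ w → (P w → accept (tabulate (content w ∘ f)) ≡ true)
                                       × (accept (tabulate (content w ∘ f)) ≡ true → P w))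
      decisionTree {zero} f accept with accept []
      ... | true  = U ⊛ , full , λ w → (λ _ → ≡.refl) , _
      ... | false = ∁ (U ⊛) , complement full , λ w → (λ ¬U → ⊥-elim (¬U _)) , λ ()
      decisionTree {suc m} f accept =
        let (P , combᴾ , specᴾ) = decisionTree (f ∘ suc) (accept ∘ (true ∷_))
            (Q , combꟴ , specꟴ) = decisionTree (f ∘ suc) (accept ∘ (false ∷_))
            C = Contains (f zero)
        in (C ∩ P) ∪ (∁ C ∩ Q)
         , union (intersection (contains (f zero)) combᴾ) (intersection (complement (contains (f zero))) combꟴ)
         , λ w → select w (specᴾ w) (specꟴ w)
        where
        select : ∀ w {P Q : Set} →
          (P → accept (true ∷ tabulate (content w ∘ f ∘ suc)) ≡ true)
          × (accept (true ∷ tabulate (content w ∘ f ∘ suc)) ≡ true → P) →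
          (Q → accept (false ∷ tabulate (content w ∘ f ∘ suc)) ≡ true)
          × (accept (false ∷ tabulate (content w ∘ f ∘ suc)) ≡ true → Q) →
          ((Contains (f zero) w × P) ⊎ (¬ Contains (f zero) w × Q) → accept (tabulate (content w ∘ f)) ≡ true)
          × (accept (tabulate (content w ∘ f)) ≡ true → (Contains (f zero) w × P) ⊎ (¬ Contains (f zero) w × Q))
        -- The same instance of excluded middle computes the head of the tabulated content, so
        -- matching on it lets the argument of `accept` reduce.
        select w (P⁺ , P⁻) (Q⁺ , Q⁻) with em {P = ∃[ i ] Word.letter w i ≡ f zero}
        ... | yes (i , eq) = (λ { (inj₁ (_ , p)) → P⁺ p ; (inj₂ (¬c , _)) → ⊥-elim (¬c λ none → none i eq) })
                           , (λ acc → inj₁ ((λ none → none i eq) , P⁻ acc))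
        ... | no ¬i        = (λ { (inj₁ (c , _)) → ⊥-elim (c λ i eq → ¬i (i , eq)) ; (inj₂ (_ , q)) → Q⁺ q })
                           , (λ acc → inj₂ ((λ c → c λ i eq → ¬i (i , eq)) , Q⁻ acc))

    -- The syntactic algebra of an invariant language

    module Syntactic where
      infixr 6 _∪ᵇ_
      _∪ᵇ_ : (A → Bool) → (A → Bool) → A → Bool
      (C ∪ᵇ D) x = C x ∨ D x

      -- Contexts reduce to unions, since inserting a word into a context only adds letters.
      infix 4 _≈_
      record _≈_ (C D : A → Bool) : Set where
        constructor congruent
        field at : ∀ E → accepts (C ∪ᵇ E) ≡ accepts (D ∪ᵇ E)
      open _≈_

      S-setoid : Setoid 0ℓ 0ℓ
      S-setoid = record
        { Carrier       = A → Bool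
        ; _≈_           = _≈_
        ; isEquivalence = record
          { refl  = congruent λ _ → ≡.refl
          ; sym   = λ eq → congruent λ E → ≡.sym (at eq E)
          ; trans = λ eq eq′ → congruent λ E → ≡.trans (at eq E) (at eq′ E)
          }
        }

      open Setoid S-setoid using (refl; sym; trans)
      open WordEquality S-setoid using (_≅_)

      ≗⇒≈ : ∀ {C D} → C ≗ D → C ≈ D
      ≗⇒≈ eq = congruent λ E → accepts-cong λ x → cong (_∨ E x) (eq x)

      ∪ᵇ-congˡ : ∀ {C D} E → C ≈ D → C ∪ᵇ E ≈ D ∪ᵇ E
      ∪ᵇ-congˡ {C} {D} E eq = congruent λ F → ≡.trans (accepts-cong λ x → Bool.∨-assoc (C x) (E x) (F x))
        (≡.trans (at eq (E ∪ᵇ F)) (accepts-cong λ x → ≡.sym (Bool.∨-assoc (D x) (E x) (F x))))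

      ∪ᵇ-comm : ∀ C D → C ∪ᵇ D ≗ D ∪ᵇ C
      ∪ᵇ-comm C D x = Bool.∨-comm (C x) (D x)

      ∪ᵇ-congʳ : ∀ {C D} E → C ≈ D → E ∪ᵇ C ≈ E ∪ᵇ D
      ∪ᵇ-congʳ {C} {D} E eq =
        trans (≗⇒≈ (∪ᵇ-comm E C)) (trans (∪ᵇ-congˡ E eq) (≗⇒≈ (∪ᵇ-comm D E)))

      ∪ᵇ⁻ : ∀ C D {x} → (C ∪ᵇ D) x ≡ true → C x ≡ true ⊎ D x ≡ true
      ∪ᵇ⁻ C D {x} eq with C x
      ... | true  = inj₁ ≡.refl
      ... | false = inj₂ eq

      ∪ᵇ⁺ˡ : ∀ C D {x} → C x ≡ true → (C ∪ᵇ D) x ≡ true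
      ∪ᵇ⁺ˡ C D {x} eq = cong (_∨ D x) eq

      ∪ᵇ⁺ʳ : ∀ C D {x} → D x ≡ true → (C ∪ᵇ D) x ≡ true
      ∪ᵇ⁺ʳ C D {x} eq = ≡.trans (cong (C x ∨_) eq) (Bool.∨-zeroʳ (C x))

      ⋃ : {I : Set} → (I → A → Bool) → A → Bool
      ⋃ C x = ⌊ ∃[ i ] C i x ≡ true ⌋

      -- Since the alphabet is finite, only finitely many members of D contribute to the union.
      absorb : {I : Set} (X : A → Bool) (D : I → A → Bool) → (∀ i → X ∪ᵇ D i ≈ X) → X ∪ᵇ ⋃ D ≈ X
      absorb X D absorbs = let (Z , Z≈X , Z⊆ , X⊆Z , D⊆Z) = partial letterAt in
        trans (≗⇒≈ λ x → ≡true-ext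
          (λ eq → [ X⊆Z , (λ d → subst (λ y → Z y ≡ true) (letterAt-index x)
               (D⊆Z (index x) (subst (λ y → ⋃ D y ≡ true) (≡.sym (letterAt-index x)) d))) ]′ (∪ᵇ⁻ X (⋃ D) eq))
          Z⊆) Z≈X
        where
        partial : ∀ {m} (f : Fin m → A) → Σ (A → Bool) λ Z → Z ≈ X
          × (∀ {x} → Z x ≡ true → (X ∪ᵇ ⋃ D) x ≡ true)
          × (∀ {x} → X x ≡ true → Z x ≡ true)
          × (∀ j → ⋃ D (f j) ≡ true → Z (f j) ≡ true)
        partial {zero}  f = X , refl , ∪ᵇ⁺ˡ X (⋃ D) , id , λ ()
        partial {suc m} f with partial (f ∘ suc) | em {P = ∃[ i ] D i (f zero) ≡ true}
        ... | Z , Z≈X , Z⊆ , X⊆Z , D⊆Z | no ¬i =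
          Z , Z≈X , Z⊆ , X⊆Z , λ { zero eq → ⊥-elim (¬i (⌊⌋⁻ eq)) ; (suc j) eq → D⊆Z j eq }
        ... | Z , Z≈X , Z⊆ , X⊆Z , D⊆Z | yes (i , Di) =
          Z ∪ᵇ D i , trans (∪ᵇ-congˡ (D i) Z≈X) (absorbs i)
          , (λ eq → [ Z⊆ , (λ d → ∪ᵇ⁺ʳ X (⋃ D) (⌊⌋⁺ (i , d))) ]′ (∪ᵇ⁻ Z (D i) eq))
          , ∪ᵇ⁺ˡ Z (D i) ∘ X⊆Z
          , λ { zero _ → ∪ᵇ⁺ʳ Z (D i) Di ; (suc j) eq → ∪ᵇ⁺ˡ Z (D i) (D⊆Z j eq) }

      -- Each `D i` is congruent to `C i`, which is already part of `⋃ C`.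
      ⋃-absorb : {I : Set} (C D : I → A → Bool) → (∀ i → C i ≈ D i) → ⋃ C ∪ᵇ ⋃ D ≈ ⋃ C
      ⋃-absorb C D C≈D = absorb (⋃ C) D λ i → trans (∪ᵇ-congʳ (⋃ C) (sym (C≈D i)))
        (≗⇒≈ λ x → ≡true-ext
          (λ eq → [ id , (λ c → ⌊⌋⁺ (i , c)) ]′ (∪ᵇ⁻ (⋃ C) (C i) eq))
          (∪ᵇ⁺ˡ (⋃ C) (C i)))

      -- Compatibility with binary union replaces one member at a time, whereas here infinitely many
      -- may change at once; mutual absorption of the two unions bridges the gap.
      ⋃-cong : {I : Set} (C D : I → A → Bool) → (∀ i → C i ≈ D i) → ⋃ C ≈ ⋃ D
      ⋃-cong C D C≈D = trans (sym (⋃-absorb C D C≈D))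
        (trans (≗⇒≈ (∪ᵇ-comm (⋃ C) (⋃ D))) (⋃-absorb D C (λ i → sym (C≈D i))))

      S : ⊛Monoid 0ℓ 0ℓ
      S .⊛Monoid.setoid                = S-setoid
      S .⊛Monoid.π w                   = ⋃ (Word.letter w)
      S .⊛Monoid.π-cong {v} {w} v≅w    =
        trans (⋃-cong (Word.letter v) (Word.letter w ∘ to) letters)
          (≗⇒≈ λ x → ⌊⌋-cong (λ (i , eq) → to i , eq)
            (λ (j , eq) → from j , ≡.trans (cong (λ k → Word.letter w k x) (strictlyInverseˡ j)) eq))
        where open _≅_ v≅w
      S .⊛Monoid.π-singleton C         = ≗⇒≈ λ x → ≡true-ext (single x ∘ ⌊⌋⁻) (λ eq → ⌊⌋⁺ (zero , eq))
        where
        single : ∀ x → ∃[ i ] lookup (C ∷ []) i x ≡ true → C x ≡ true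
        single x (zero , eq) = eq
      S .⊛Monoid.π-concat u            = ≗⇒≈ λ x → ⌊⌋-cong
        (λ ((i , j) , eq) → i , ⌊⌋⁺ (j , eq))
        (λ (i , eq) → let (j , eq′) = ⌊⌋⁻ eq in (i , j) , eq′)

      open ⊛Monoid S using (_∙_)

      contentᴹ : Morphism (free A) S
      contentᴹ .Morphism.⟦_⟧                 = content
      contentᴹ .Morphism.⟦⟧-cong {v} {w} v≅w = ≗⇒≈ (same⇒content-≗ {v} {w}
        ((λ x → to x , ≡.sym (letters x))
        , λ y → from y , ≡.trans (letters (from y)) (cong (Word.letter w) (strictlyInverseˡ y))))
        where open WordEquality._≅_ v≅w
      contentᴹ .Morphism.homo u              = ≗⇒≈ λ x → ⌊⌋-cong
        (λ ((i , j) , eq) → i , ⌊⌋⁺ (j , eq))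
        (λ (i , eq) → let (j , eq′) = ⌊⌋⁻ eq in (i , j) , eq′)

      -- Acceptance itself is the instance of the congruence at the empty set `λ _ → false`.
      S-recognizes : S Recognizes L
      S-recognizes = contentᴹ
        , (λ {w} w∈L → w , w∈L , refl)
        , λ {w} (v , v∈L , eq) → proj₂ (accepts-content {w = w} (empty w))
            (≡.trans (at eq (λ _ → false)) (proj₁ (accepts-content {w = v} (empty v)) v∈L))
        where
        empty : ∀ w → content w ∪ᵇ (λ _ → false) ≗ content w
        empty w x = Bool.∨-identityʳ (content w x)

      S-finite : IsFinite S
      S-finite = finiteQuotient em S-setoid subset λ C →
        funToFin (code ∘ C ∘ letterAt) , ≗⇒≈ λ x →
          ≡.trans (cong decode (Fin.finToFun-funToFin (code ∘ C ∘ letterAt) (index x)))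
          (≡.trans (Inverse.strictlyInverseˡ Fin.2↔Bool _) (cong C (letterAt-index x)))
        where
        open Inverse Fin.2↔Bool using () renaming (to to decode; from to code)
        subset : Fin (2 ℕ.^ n) → A → Bool
        subset i x = decode (finToFun i (index x))

      -- Both sides are the union of the entries: by density every entry occurs in the shuffle, for
      -- instance between 0 and 1.
      S-trivial : ShuffleTrivial S
      S-trivial xs = ≗⇒≈ λ x → ≡true-ext (⊆ x ∘ ⌊⌋⁻) (⌊⌋⁺ ∘ ⊇ x)
        where
        foldr₁⁺ : ∀ {m} (xs : Vec (A → Bool) (suc m)) i {x} → lookup xs i x ≡ true → foldr₁ _∙_ xs x ≡ true
        foldr₁⁺ (C ∷ [])     zero    eq = eq
        foldr₁⁺ (C ∷ D ∷ Cs) zero    eq = ⌊⌋⁺ (zero , eq)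
        foldr₁⁺ (C ∷ D ∷ Cs) (suc i) eq = ⌊⌋⁺ (suc zero , foldr₁⁺ (D ∷ Cs) i eq)

        foldr₁⁻ : ∀ {m} (xs : Vec (A → Bool) (suc m)) {x} → foldr₁ _∙_ xs x ≡ true → ∃[ i ] lookup xs i x ≡ true
        foldr₁⁻ (C ∷ [])     eq = zero , eq
        foldr₁⁻ (C ∷ D ∷ Cs) eq with ⌊⌋⁻ eq
        ... | zero     , eq′ = zero , eq′
        ... | suc zero , eq′ = let (i , eq″) = foldr₁⁻ (D ∷ Cs) eq′ in suc i , eq″

        ⊆ : ∀ x → ∃[ q ] Word.letter (shuffle xs) q x ≡ true → foldr₁ _∙_ xs x ≡ true
        ⊆ x (q , eq) = foldr₁⁺ xs (colour _ q) eq

        ⊇ : ∀ x → foldr₁ _∙_ xs x ≡ true → ∃[ q ] Word.letter (shuffle xs) q x ≡ true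
        ⊇ x eq with foldr₁⁻ xs eq
        ... | i , eq′ with shuffle-dense xs (ℚ.positive⁻¹ ℚ.1ℚ) i
        ...   | q , _ , _ , letter≡ = q , ≡.trans (cong (λ C → C x) letter≡) eq′

      -- The range of `h` maps onto `S` by sending the value of a word to its content. This is well
      -- defined: any set of letters can be appended as a word, so words with equal values have
      -- congruent contents.
      S-minimal : (M : ⊛Monoid 0ℓ 0ℓ) → M Recognizes L → S Divides M
      S-minimal M (h , L⊆ , ⊆L) = image , toContent , λ C →
        (⟦ wordOf C ⟧ , fromWitness (wordOf C , M.refl))
        , trans (⟦⟧-≈⇒≈ (proj₂ (preimage {⟦ wordOf C ⟧} _))) (≗⇒≈ (content-wordOf C))
        where
        open Morphism h
        module M = ⊛Monoid M

        InImage : Pred M.Carrier _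
        InImage x = Σ (Word A) λ w → ⟦ w ⟧ M.≈ x

        preimage : ∀ {x} → True (em {P = InImage x}) → InImage x
        preimage = toWitness

        image : Sub⊛Monoid M 0ℓ
        -- Having a preimage quantifies over all words, a large type; `True` brings it down to the
        -- level that `_Divides_` prescribes.
        image .Sub⊛Monoid.member x       = True (em {P = InImage x})
        image .Sub⊛Monoid.respects x≈y m = let (w , eq) = preimage m in fromWitness (w , M.trans eq x≈y)
        image .Sub⊛Monoid.closed u m     = fromWitness
          ( concat (record { dom = Word.dom u ; letter = λ i → proj₁ (preimage (m i)) })
          , M.trans (homo _) (M.π-cong (WordEquality.monotone-surjection M.setoid
              (λ i → i) (λ lt → lt) (λ i → i , ≡.refl) (λ i → proj₂ (preimage (m i))))))

        same-membership : ∀ {v w} → ⟦ v ⟧ M.≈ ⟦ w ⟧ → L v → L w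
        same-membership eq v∈L = let (u , u∈L , eq′) = L⊆ v∈L in ⊆L (u , u∈L , M.trans (M.sym eq) eq′)

        append : Word A → Word A → Word A
        append v w = concat (finite (v ∷ w ∷ []))

        content-append : ∀ v w → content (append v w) ≗ content v ∪ᵇ content w
        content-append v w x = ≡true-ext (λ eq → forth (⌊⌋⁻ eq)) (λ eq → back (∪ᵇ⁻ (content v) (content w) eq))
          where
          forth : ∃[ i ] Word.letter (append v w) i ≡ x → (content v ∪ᵇ content w) x ≡ true
          forth ((zero , i) , eq)     = ∪ᵇ⁺ˡ (content v) (content w) (⌊⌋⁺ (i , eq))
          forth ((suc zero , i) , eq) = ∪ᵇ⁺ʳ (content v) (content w) (⌊⌋⁺ (i , eq))
          back : content v x ≡ true ⊎ content w x ≡ true → content (append v w) x ≡ true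
          back (inj₁ eq) = let (i , eq′) = ⌊⌋⁻ eq in ⌊⌋⁺ ((zero , i) , eq′)
          back (inj₂ eq) = let (i , eq′) = ⌊⌋⁻ eq in ⌊⌋⁺ ((suc zero , i) , eq′)

        ⟦append⟧ : ∀ {v w} u → ⟦ v ⟧ M.≈ ⟦ w ⟧ → ⟦ append v u ⟧ M.≈ ⟦ append w u ⟧
        ⟦append⟧ u eq = M.trans (homo _) (M.trans
          (M.π-cong (WordEquality.monotone-surjection M.setoid (λ i → i) (λ lt → lt) (λ i → i , ≡.refl)
            λ { zero → eq ; (suc zero) → M.refl }))
          (M.sym (homo _)))

        ⟦⟧-≈⇒≈ : ∀ {v w} → ⟦ v ⟧ M.≈ ⟦ w ⟧ → content v ≈ content w
        ⟦⟧-≈⇒≈ eq = congruent λ E → ≡true-ext (half E eq) (half E (M.sym eq))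
          where
          spelled : ∀ E v → content v ∪ᵇ E ≗ content (append v (wordOf E))
          spelled E v x = ≡.trans (cong (content v x ∨_) (≡.sym (content-wordOf E x)))
            (≡.sym (content-append v (wordOf E) x))
          half : ∀ E {v w} → ⟦ v ⟧ M.≈ ⟦ w ⟧ → accepts (content v ∪ᵇ E) ≡ true → accepts (content w ∪ᵇ E) ≡ true
          half E {v} {w} eq acc = proj₁ (accepts-content {w = append w (wordOf E)} (spelled E w))
            (same-membership (⟦append⟧ (wordOf E) eq)
              (proj₂ (accepts-content {w = append v (wordOf E)} (spelled E v)) acc))

        toContent : Morphism (Sub⊛Monoid.⊛monoid image) S
        toContent .Morphism.⟦_⟧ (_ , m)                      = content (proj₁ (preimage m))
        toContent .Morphism.⟦⟧-cong {_ , m} {_ , m′} x≈y = ⟦⟧-≈⇒≈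
          (M.trans (proj₂ (preimage m)) (M.trans x≈y (M.sym (proj₂ (preimage m′)))))
        toContent .Morphism.homo u                         = trans
          (⟦⟧-≈⇒≈ {w = concat words} (M.trans (proj₂ (preimage (proj₂ (⊛Monoid.π (Sub⊛Monoid.⊛monoid image) u))))
            (M.trans (M.π-cong (WordEquality.monotone-surjection M.setoid (λ i → i) (λ lt → lt) (λ i → i , ≡.refl)
               (λ i → M.sym (proj₂ (preimage (proj₂ (Word.letter u i)))))))
            (M.sym (homo words)))))
          (Morphism.homo contentᴹ words)
          where
          words : Word (Word A)
          words = record { dom = Word.dom u ; letter = λ i → proj₁ (preimage (proj₂ (Word.letter u i))) }

      S-syntactic : IsSyntactic S L
      S-syntactic = record { isFinite = S-finite ; recognizes = S-recognizes ; minimal = S-minimal }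

-- The equivalence of the five conditions

theorem1 : (em : ∀ {ℓ} → ExcludedMiddle ℓ) →
    ∀ {p} {A : Set} → Finite A → (L : Language A p) → Regular L →
    let
    [1] = Σ (⊛Monoid 0ℓ 0ℓ) λ M → IsFinite M × ShuffleTrivial M × M Recognizes L
    [2] = ∃[ P ] BooleanCombination _⊛ P × L ≐ P
    [3] = FO^ 1 -Definable L
    [4] = Σ ℕ λ n → (U₁ em ^ n) Recognizes L
    [5] = Σ (⊛Monoid 0ℓ 0ℓ) λ S → IsSyntactic S L × ShuffleTrivial S
    in ([1] ⇔ [2]) × ([2] ⇔ [3]) × ([3] ⇔ [4]) × ([4] ⇔ [5])
theorem1 em {p} {A} finiteA L _ =
    -- A boolean combination is seen to be invariant through its one-variable sentence.
    mk⇔ (combination ∘ shuffleTrivial⇒CI) (syntactic⇒shuffleTrivial ∘ syntactic ∘ definable⇒invariant ∘ sentence)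
  , mk⇔ sentence (combination ∘ definable⇒invariant)
  , mk⇔ (invariant⇒product ∘ definable⇒invariant) (sentence ∘ combination ∘ product⇒CI)
  , mk⇔ (syntactic ∘ product⇒CI) (invariant⇒product ∘ shuffleTrivial⇒CI ∘ syntactic⇒shuffleTrivial)
  where
  open Invariance em finiteA

  [1] [5] : Set _
  [1] = Σ (⊛Monoid 0ℓ 0ℓ) λ M → IsFinite M × ShuffleTrivial M × M Recognizes L
  [5] = Σ (⊛Monoid 0ℓ 0ℓ) λ S → IsSyntactic S L × ShuffleTrivial S

  shuffleTrivial⇒CI : [1] → ContentInvariant L
  shuffleTrivial⇒CI (M , finite , trivial , recognizes) =
    recognizes⇒invariant {M = M} (Condensation.π-content em {M} finite trivial) recognizes

  product⇒CI : (Σ ℕ λ k → (U₁ em ^ k) Recognizes L) → ContentInvariant L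
  product⇒CI (k , recognizes) = recognizes⇒invariant {M = U₁ em ^ k} (U₁-Product.power-content k) recognizes

  combination : ContentInvariant L → ∃[ P ] BooleanCombination _⊛ P × L ≐ P
  combination = invariant⇒combination

  sentence : (∃[ P ] BooleanCombination _⊛ P × L ≐ P) → FO^ 1 -Definable L
  sentence (P , comb , L⊆P , P⊆L) = let (φ , P⊆φ , φ⊆P) = Definability.combination⇒sentence comb in
    φ , (P⊆φ ∘ L⊆P) , (P⊆L ∘ φ⊆P)

  syntactic : ContentInvariant L → [5]
  syntactic inv = Syntactic.S inv , Syntactic.S-syntactic inv , Syntactic.S-trivial inv

  syntactic⇒shuffleTrivial : [5] → [1]
  syntactic⇒shuffleTrivial (S , syn , trivial) =
    S , IsSyntactic.isFinite syn , trivial , IsSyntactic.recognizes syn
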